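{- Let $n$ and $d$ be positive integers, $L$ a $(p,q)$-leaper with $p\ne0$ and $p<q$, and $M$ an $(r,s)$-leaper with \[\binom rs=A^{\mathrm{Pinwheel}}_n\binom pq,\qquad A^{\mathrm{Pinwheel}}_n=\begin{pmatrix}0&1\\1&2n\end{pmatrix}.\] Then the expanded pinwheel board $W_{n,d}(L)$ of order $n$ and margin $d$ for $L$ is dual with respect to $L$ and $M$. Furthermore, the leaper graph of $L$ over $W_{n,d}(L)$ is trivial (it contains no nontrivial cycle) and the direction graph extracted from it depends only on $n$ and $d$ (and not on $L$). Denote this direction graph by $W_{n,d}$. It is a dual direction graph of complement $\pi_{\mathrm{Pinwheel}}(W_{n,d})$ when $n$ is odd and $\pi_{\mathrm{Reflect}}\circ\pi_{\mathrm{Pinwheel}}(W_{n,d})$ when $n$ is even, and duality matrix $A^{\mathrm{Pinwheel}}_n$. Here $\pi_{\mathrm{Pinwheel}}$ is the permutation of the eight skew directions sending $1,2,3,4,5,6,7,8$ to $3,8,5,2,7,4,1,6$ respectively, and $\pi_{\mathrm{Reflect}}(i)=9-i$.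
   Context: A square is a unit square of the infinite chessboard; a board is a set of squares. For nonnegative integers $p,q$, not both zero, a $(p,q)$-leaper is a piece that moves from a square $a$ to any of $a+(\pm p,\pm q)$, $a+(\pm q,\pm p)$; a $(p,q)$-leaper and a $(q,p)$-leaper are the same leaper; it is skew if $p,q$ are nonzero and distinct. The leaper graph of $L$ over a board $B$ has the squares of $B$ as vertices, two being adjacent when a move of $L$ joins them. A board $B$ is dual with respect to two distinct leapers $L$ and $M$ if $B$ contains more than one square and the leaper graphs of $L$ and $M$ over $B$ are connected and isomorphic. Expanded pinwheel boards. Given a $(p,q)$-leaper $L$ with $q\ne0$, use Cartesian coordinates with origin $O$ over the infinite chessboard such that the integer points are the vertices of the squares if $p+q$ is odd, and the centers of the squares if $p+q$ is even; $(x,y)$ denotes the square centered at $(x,y)$. Let $N^{\mathrm I}(L)$ be the set of all squares $(x,y)$ with $x\equiv\frac12(p+q)$ and $y\equiv\frac12(p-q)$ modulo $2q$. Let $W^{\mathrm I}_{n,d}(L)$ be the board formed by all squares of $N^{\mathrm I}(L)$ whose centers lie on the boundary or in the interior of the rectangle bounded by $p-2dq\le x+y\le p+2(n+d)q$ and $-(2n+2d-1)q\le y-x\le(2n+2d-1)q$. Let $W^{\mathrm{II}}_{n,d}(L)$, $W^{\mathrm{III}}_{n,d}(L)$, $W^{\mathrm{IV}}_{n,d}(L)$ be the rotations of $W^{\mathrm I}_{n,d}(L)$ by $90^\circ$, $180^\circ$, and $270^\circ$ counterclockwise about $O$. The expanded pinwheel board $W_{n,d}(L)$ is the union of these four boards.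 Direction graphs. Let $A_1=\begin{pmatrix}0&1\\1&0\end{pmatrix}$, $A_2=\begin{pmatrix}1&0\\0&1\end{pmatrix}$, $A_3=\begin{pmatrix}-1&0\\0&1\end{pmatrix}$, $A_4=\begin{pmatrix}0&-1\\1&0\end{pmatrix}$, and $A_{i+4}=-A_i$ for $i=1,\ldots,4$; these eight are the direction matrices. A move of a skew $(p,q)$-leaper, $p<q$, by a translation $v$ has (skew) direction $i\in\{1,\ldots,8\}$ and direction matrix $A_i$ if $v^T=A_i\binom pq$. A direction graph is a symmetric directed graph whose arcs are labeled with skew directions so that the sum of the associated direction matrices over every simple directed cycle (including two-cycles) is zero. Two direction graphs are the same if there is a label-preserving isomorphism between them. A simple cycle of a skew leaper is trivial if the sum of the direction matrices of its moves (in either orientation) is zero, and nontrivial otherwise. If a leaper graph $G$ of a skew leaper contains no nontrivial cycle, the direction graph extracted from $G$ has the squares of $G$ as vertices and, for each pair of adjacent squares $a,b$, an arc from $a$ to $b$ and an arc from $b$ to $a$, each labeled with the direction of the corresponding move. For a permutation $\pi$ of the skew directions, $\pi(\Phi)$ is obtained from $\Phi$ by applying $\pi$ to every arc label. Duality. For vertices $x,y$ in the same connected component of a direction graph, the distance from $x$ to $y$ is the sum of the direction matrices along any path from $x$ to $y$ (it does not depend on the path). A direction graph is coherent if, for all such $x,y$, the distance from $x$ to $y$ is the zero matrix if and only if $x=y$, and is a direction matrix if and only if $x$ and $y$ are joined by an arc. A direction graph $\Phi$ is dual if there exist a direction graph $\Phi'$ (a complement of $\Phi$), a one-to-one mapping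 $\eta$ between the vertex sets of $\Phi$ and $\Phi'$, and a real $2\times2$ matrix $A_{\mathrm{Dual}}$ (the duality matrix), distinct from all direction matrices, such that: $\Phi$ and $\Phi'$ are coherent and connected; the unlabeled symmetric directed graphs underlying $\Phi$ and $\Phi'$ are isomorphic; and for every arc from $\eta(a)$ to $\eta(b)$ labeled $i$ in $\Phi'$, the distance from $a$ to $b$ in $\Phi$ equals $A_iA_{\mathrm{Dual}}$. -}

module Defs where

open import Data.Fin.Base using (Fin)
open import Data.Fin.Patterns using (0F; 1F; 2F; 3F; 4F; 5F; 6F; 7F)
open import Data.Fin.Permutation using (Permutation′; permutation; reverse; _⟨$⟩ʳ_)
open import Data.Integer.Base using (ℤ; +_; 0ℤ; 1ℤ; -1ℤ; _+_; _*_; _-_; -_; _≤_; _◃_)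
open import Data.Integer.Divisibility.Signed using (_∣_)
open import Data.List.Base using (List; []; _∷_; length)
open import Data.List.Relation.Unary.Unique.Propositional using (Unique)
open import Data.Nat.Base as ℕ using (ℕ; _%_)
open import Data.Product.Base using (Σ-syntax; ∃; ∃₂; ∃-syntax; _×_; _,_)
open import Data.Refinement.Base using (Refinement; value)
open import Data.Sum.Base using (_⊎_)
open import Function.Bundles using (_↔_; _⇔_; Inverse)
open import Level using (0ℓ)
open import Relation.Binary.Construct.Closure.ReflexiveTransitive using (Star; ε; _◅_)
open import Relation.Binary.Core using (Rel)
open import Relation.Binary.PropositionalEquality.Core using (_≡_; _≢_; refl)
open import Relation.Nullary.Negation.Core using (¬_)
open import Relation.Unary using (Pred; _∪_; _⊢_)

------------------------------------------------------------------------
-- Integer vectors and 2×2 matrices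

Vec² : Set
Vec² = ℤ × ℤ

infixl 6 _+ᵛ_
_+ᵛ_ : Vec² → Vec² → Vec²
(a , b) +ᵛ (c , d) = (a + c , b + d)

-- The entries are listed row by row.
record Matrix : Set where
  constructor mat
  field
    m₁₁ m₁₂ m₂₁ m₂₂ : ℤ

infix  8 -ᴹ_
infixl 7 _*ᴹ_ _*ᵛ_
infixl 6 _+ᴹ_

0ᴹ : Matrix
0ᴹ = mat 0ℤ 0ℤ
         0ℤ 0ℤ

-ᴹ_ : Matrix → Matrix
-ᴹ mat a b c d = mat (- a) (- b) (- c) (- d)

_+ᴹ_ : Matrix → Matrix → Matrix
mat a b c d +ᴹ mat a′ b′ c′ d′ = mat (a + a′) (b + b′) (c + c′) (d + d′)

_*ᴹ_ : Matrix → Matrix → Matrix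
mat a b c d *ᴹ mat a′ b′ c′ d′ =
  mat (a * a′ + b * c′) (a * b′ + b * d′)
      (c * a′ + d * c′) (c * b′ + d * d′)

_*ᵛ_ : Matrix → Vec² → Vec²
mat a b c d *ᵛ (x , y) = (a * x + b * y , c * x + d * y)

------------------------------------------------------------------------
-- Directed graphs

record Digraph : Set₁ where
  field
    Vertex : Set
    Edge   : Rel Vertex 0ℓ

Connected : Digraph → Set
Connected G = ∀ x y → Star Edge x y
  where open Digraph G

record Isomorphism (G H : Digraph) : Set where
  private
    module G = Digraph G
    module H = Digraph H
  field
    bijection : G.Vertex ↔ H.Vertex
  open Inverse bijection using (to)
  field
    edges : ∀ {x y} → G.Edge x y ⇔ H.Edge (to x) (to y)

------------------------------------------------------------------------
-- Leapers and boards

Square : Set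
Square = Vec²

Board : Set₁
Board = Pred Square 0ℓ

-- Membership is irrelevant, so that equality of squares of a board is
-- equality of the underlying squares.
SquareOf : Board → Set
SquareOf B = Refinement Square B

record Leaper : Set where
  constructor leaper
  field
    p q     : ℕ
    nonzero : ¬ (p ≡ 0 × q ≡ 0)

  vector : Vec²
  vector = (+ p , + q)

  Move : Rel Square 0ℓ
  Move a b = ∃₂ λ s t → b ≡ a +ᵛ (s ◃ p , t ◃ q) ⊎ b ≡ a +ᵛ (s ◃ q , t ◃ p)

SameLeaper : Rel Leaper 0ℓ
SameLeaper L M = (L.p ≡ M.p × L.q ≡ M.q) ⊎ (L.p ≡ M.q × L.q ≡ M.p)
  where
  module L = Leaper L
  module M = Leaper M

leaperGraph : Leaper → Board → Digraph
leaperGraph L B = record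
  { Vertex = SquareOf B
  ; Edge   = λ a b → Leaper.Move L (value a) (value b)
  }

record IsDualBoard (B : Board) (L M : Leaper) : Set where
  field
    distinct      : ¬ SameLeaper L M
    manySquares   : ∃₂ λ (a b : SquareOf B) → a ≢ b
    connectedˡ    : Connected (leaperGraph L B)
    connectedʳ    : Connected (leaperGraph M B)
    isomorphic    : Isomorphism (leaperGraph L B) (leaperGraph M B)

------------------------------------------------------------------------
-- Expanded pinwheel boards

infix 4 _≡_[mod_]
_≡_[mod_] : ℤ → ℤ → ℤ → Set
x ≡ y [mod m ] = m ∣ x - y

-- The centers of squares may be half-integral.  The point (x , y) is
-- therefore represented by its doubled coordinates (2x , 2y).
Point : Set
Point = Vec²

-- The integer points are the vertices of the squares when p + q is odd
-- and the centers of the squares when p + q is even.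
center : Leaper → Square → Point
center L (a , b) = (+ 2 * a + offset , + 2 * b + offset)
  where
  open Leaper L
  offset = + ((p ℕ.+ q) % 2)

-- All conditions are doubled.  A point satisfying the two congruences is
-- automatically the center of a square.
WI : ℕ → ℕ → Leaper → Pred Point 0ℓ
WI n d L (2x , 2y) =
    2x ≡ P + Q [mod + 2 * (+ 2 * Q) ]
  × 2y ≡ P - Q [mod + 2 * (+ 2 * Q) ]
  × + 2 * (P - + 2 * D * Q) ≤ 2x + 2y
  × 2x + 2y ≤ + 2 * (P + + 2 * (N + D) * Q)
  × + 2 * (- (+ 2 * N + + 2 * D - 1ℤ) * Q) ≤ 2y - 2x
  × 2y - 2x ≤ + 2 * ((+ 2 * N + + 2 * D - 1ℤ) * Q)
  where
  P = + Leaper.p L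
  Q = + Leaper.q L
  N = + n
  D = + d

rotateClockwise : Point → Point
rotateClockwise (x , y) = (y , - x)

-- The counterclockwise rotation by 90° of a set of points: a point lies
-- in it when the clockwise rotation of the point lies in the set.
rotated : Pred Point 0ℓ → Pred Point 0ℓ
rotated S = rotateClockwise ⊢ S

expandedPinwheelBoard : ℕ → ℕ → Leaper → Board
expandedPinwheelBoard n d L = center L ⊢ (I ∪ II ∪ III ∪ IV)
  where
  I   = WI n d L
  II  = rotated I
  III = rotated II
  IV  = rotated III

pinwheelMatrix : ℕ → Matrix
pinwheelMatrix n = mat 0ℤ 1ℤ
                       1ℤ (+ 2 * + n)

------------------------------------------------------------------------
-- Directions

Direction : Set
Direction = Fin 8

pattern d₁ = 0F
pattern d₂ = 1F
pattern d₃ = 2F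
pattern d₄ = 3F
pattern d₅ = 4F
pattern d₆ = 5F
pattern d₇ = 6F
pattern d₈ = 7F

directionMatrix : Direction → Matrix
directionMatrix d₁ = mat 0ℤ 1ℤ
                         1ℤ 0ℤ
directionMatrix d₂ = mat 1ℤ 0ℤ
                         0ℤ 1ℤ
directionMatrix d₃ = mat -1ℤ 0ℤ
                          0ℤ 1ℤ
directionMatrix d₄ = mat 0ℤ -1ℤ
                         1ℤ  0ℤ
directionMatrix d₅ = -ᴹ directionMatrix d₁
directionMatrix d₆ = -ᴹ directionMatrix d₂
directionMatrix d₇ = -ᴹ directionMatrix d₃
directionMatrix d₈ = -ᴹ directionMatrix d₄

π-pinwheel : Permutation′ 8
π-pinwheel = permutation to from
  (λ { d₁ → refl ; d₂ → refl ; d₃ → refl ; d₄ → refl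
     ; d₅ → refl ; d₆ → refl ; d₇ → refl ; d₈ → refl })
  (λ { d₁ → refl ; d₂ → refl ; d₃ → refl ; d₄ → refl
     ; d₅ → refl ; d₆ → refl ; d₇ → refl ; d₈ → refl })
  where
  to from : Direction → Direction

  to d₁ = d₃
  to d₂ = d₈
  to d₃ = d₅
  to d₄ = d₂
  to d₅ = d₇
  to d₆ = d₄
  to d₇ = d₁
  to d₈ = d₆

  from d₁ = d₇
  from d₂ = d₄
  from d₃ = d₁
  from d₄ = d₆
  from d₅ = d₃
  from d₆ = d₈
  from d₇ = d₅
  from d₈ = d₂

-- With directions numbered from 1 this is i ↦ 9 - i.
π-reflect : Permutation′ 8
π-reflect = reverse

------------------------------------------------------------------------
-- Labelled directed graphs and direction graphs

-- Arc x y i: there is an arc from x to y labelled i.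
record LabelledGraph : Set₁ where
  field
    Vertex : Set
    Arc    : Vertex → Vertex → Direction → Set

  underlying : Digraph
  underlying = record
    { Vertex = Vertex
    ; Edge   = λ x y → ∃[ i ] Arc x y i
    }

  Walk : Rel Vertex 0ℓ
  Walk = Star (Digraph.Edge underlying)

  total : ∀ {x y} → Walk x y → Matrix
  total ε             = 0ᴹ
  total ((i , _) ◅ w) = directionMatrix i +ᴹ total w

  -- The vertices visited by a walk, without the last one.
  sources : ∀ {x y} → Walk x y → List Vertex
  sources ε             = []
  sources (_◅_ {x} _ w) = x ∷ sources w

  -- A loop is a simple cycle of length one and a two-cycle is a simple
  -- cycle of length two.
  IsSimpleCycle : ∀ {x} → Walk x x → Set
  IsSimpleCycle w = 0 ℕ.< length (sources w) × Unique (sources w)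

  -- In a direction graph all walks from x to y have the same total.
  Distance : Vertex → Vertex → Matrix → Set
  Distance x y D = Σ[ w ∈ Walk x y ] total w ≡ D

  Coherent : Set
  Coherent = ∀ {x y D} → Distance x y D →
      (D ≡ 0ᴹ ⇔ x ≡ y)
    × ((∃[ i ] D ≡ directionMatrix i) ⇔ (∃[ i ] Arc x y i))

record IsDirectionGraph (Φ : LabelledGraph) : Set where
  open LabelledGraph Φ
  field
    symmetric   : ∀ {x y i} → Arc x y i → ∃[ j ] Arc y x j
    labelUnique : ∀ {x y i j} → Arc x y i → Arc x y j → i ≡ j
    cycleTotal  : ∀ {x} (w : Walk x x) → IsSimpleCycle w → total w ≡ 0ᴹ

infix 4 _≅_
record _≅_ (Φ Ψ : LabelledGraph) : Set where
  private
    module Φ = LabelledGraph Φ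
    module Ψ = LabelledGraph Ψ
  field
    bijection : Φ.Vertex ↔ Ψ.Vertex
  open Inverse bijection using (to)
  field
    arcs : ∀ {x y i} → Φ.Arc x y i ⇔ Ψ.Arc (to x) (to y) i

relabel : Permutation′ 8 → LabelledGraph → LabelledGraph
relabel π Φ = record
  { Vertex = Vertex
  ; Arc    = λ x y j → ∃[ i ] (Arc x y i × π ⟨$⟩ʳ i ≡ j)
  }
  where open LabelledGraph Φ

-- Meant for skew (p , q)-leapers with p < q, each move of which has
-- exactly one direction.
extracted : Leaper → Board → LabelledGraph
extracted L B = record
  { Vertex = SquareOf B
  ; Arc    = λ a b i → Move (value a) (value b)
                     × value b ≡ value a +ᵛ directionMatrix i *ᵛ vector
  }
  where open Leaper L

-- The leaper graph of a skew (p , q)-leaper with p < q contains no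
-- nontrivial cycle.  Cycles of a leaper graph have length at least three.
IsTrivial : Leaper → Board → Set
IsTrivial L B = ∀ {x} (w : Walk x x) →
  IsSimpleCycle w → 3 ℕ.≤ length (sources w) → total w ≡ 0ᴹ
  where open LabelledGraph (extracted L B)

-- Φ is dual, with complement Φ′ and duality matrix A.  An integer A is
-- no restriction as soon as Φ′ has an arc: direction matrices are
-- invertible over the integers and distances are integer matrices.
record IsDual (Φ Φ′ : LabelledGraph) (A : Matrix) : Set where
  private
    module Φ  = LabelledGraph Φ
    module Φ′ = LabelledGraph Φ′
  field
    isDirectionGraph  : IsDirectionGraph Φ
    isDirectionGraph′ : IsDirectionGraph Φ′
    notDirection      : ∀ i → A ≢ directionMatrix i
    coherent          : Φ.Coherent
    coherent′         : Φ′.Coherent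
    connected         : Connected Φ.underlying
    connected′        : Connected Φ′.underlying
    isomorphic        : Isomorphism Φ.underlying Φ′.underlying
    η                 : Φ.Vertex ↔ Φ′.Vertex
  open Inverse η using (to)
  field
    distance : ∀ {a b i} → Φ′.Arc (to a) (to b) i →
               Φ.Distance a b (directionMatrix i *ᴹ A)

{-# OPTIONS --safe #-}
module Submission where

-- Why the theorem is true.
--
-- Up to a fixed translation, every square of the board is X (p , q) for an integer
-- matrix X, its position, which depends only on the quarter of the pinwheel
-- that contains the square and on two integers u and v, not on the leaper
-- (positionMatrix).  The first column of a position determines the quarter
-- and the parity of the second column.  As 0 < p < q, this forces squares that
-- differ by N (p , q) to have positions that differ by N, whenever N is a
-- direction matrix, or a direction matrix times the pinwheel matrix, or zero
-- (rigid).  So the graph extracted from the board is isomorphic to the graph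
-- pinwheelGraph n d on the coordinates (k , u , v), two vertices of which are
-- joined when their positions differ by a direction matrix.
--
-- A labelled graph with positions of this kind (a Potential) has no
-- nontrivial cycle, is a direction graph and is coherent, because the total
-- of a walk is the difference of the positions of its ends.
--
-- For connectedness (pinwheel-connected), put p = 0 and q = 1.  This turns the
-- graph into a subgraph of the square grid, in which the center of the pinwheel
-- lies in the middle of a cycle of four vertices, one in each quarter.  From
-- every other vertex some step that stays in the board lowers the taxicab
-- distance to the center (descend).
--
-- The permutation π-pinwheel is multiplication of the direction matrices on
-- the right by a quarter turn, and π-reflect is multiplication on the left by
-- a reflection.  Hence the relabelled graphs have potentials as well, namely
-- the positions multiplied by these matrices.  The dualizing bijection η is a
-- half-turn of each rectangle when n is odd, and a reflection of the
-- rectangles that exchanges quarters when n is even.  In both cases the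
-- relabelled position of η x, multiplied by the pinwheel matrix A on the right,
-- is the position of x up to a translation (halfTurn-affine, reflect-affine).
-- So the arcs of the complement labelled i are the pairs of vertices at
-- distance A_i A, which are precisely the moves of M.  This yields the duality
-- of the direction graph and the isomorphism between the two leaper graphs.

open import Data.Fin.Base using (Fin)
open import Data.Fin.Patterns using (0F; 1F; 2F; 3F)
open import Data.Fin.Permutation using (Permutation′; _⟨$⟩ʳ_; _⟨$⟩ˡ_; inverseʳ)
open import Data.Integer.Base using (ℤ; +_; +[1+_]; -[1+_]; 0ℤ; 1ℤ; -1ℤ; _+_; _*_; _-_; -_; _≤_; +≤+; ∣_∣; _◃_)
open import Data.Integer.Divisibility.Signed using (∣m∣n⇒∣m+n; ∣m∣n⇒∣m-n; ∣m⇒∣-m) renaming (_∣_ to _∣ᶻ_; divides to dividesᶻ; _∣?_ to _∣ᶻ?_)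
open import Data.Integer.Properties using (+-assoc; +-identityˡ; +-identityʳ; +-injective; +-mono-≤; pos-*; *-identityˡ; *-identityʳ; *-zeroʳ; *-cancelˡ-≡; *-cancelˡ-≤-pos; *-monoˡ-≤-nonNeg; neg-involutive; neg-injective; neg-distrib-+; -1*i≡-i; i-j≡0⇒i≡j; _≤?_; ≰⇒>; i<j⇒suc[i]≤j; i≤j⇒0≤j-i; 0≤i-j⇒j≤i; abs-*; ∣i∣≡0⇒i≡0; ∣-i∣≡∣i∣; ∣i+j∣≤∣i∣+∣j∣; -◃n≡-n; +◃n≡+n)
open import Data.Integer.Tactic.RingSolver using (solve-∀)
open import Data.Irrelevant using ([_])
open import Data.Nat.Base as ℕ using (ℕ; zero; suc; z≤n; s≤s; s<s; _<_)
open import Data.Nat.Divisibility using (_∣_; _∤_; _∣?_; divides; m%n≡0⇒n∣m)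
open import Data.Nat.DivMod using (m≡m%n+[m/n]*n; m%n<n)
open import Data.Nat.Induction using (<-wellFounded)
import Data.Nat.Properties as ℕ
open import Data.Product.Base using (Σ-syntax; ∃₂; ∃-syntax; _×_; _,_; proj₁; proj₂)
open import Data.Refinement.Base using (Refinement; value; _,_)
open import Data.Refinement.Properties using (value-injective)
open import Data.Sign.Base as Sign using (Sign)
open import Data.Sum.Base using (_⊎_; inj₁; inj₂)
open import Function.Base using (_∘_)
open import Function.Bundles using (_↔_; _⇔_; mk⇔; mk↔ₛ′; Inverse; Equivalence)
open import Function.Properties.Inverse using (↔-refl; ↔-sym; ↔-trans)
open import Induction.WellFounded using (Acc; acc)
open import Relation.Binary.Construct.Closure.ReflexiveTransitive using (Star; ε; _◅_; _◅◅_; gmap; reverse)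
open import Relation.Binary.PropositionalEquality.Core using (_≡_; _≢_; refl; sym; trans; cong; cong₂; subst; subst₂)
open import Relation.Binary.PropositionalEquality.Properties using (module ≡-Reasoning)
open import Relation.Nullary.Decidable.Core using (Dec; yes; no; recompute; _×-dec_; _⊎-dec_)
open import Relation.Nullary.Negation.Core using (¬_; contradiction)
open import Defs

------------------------------------------------------------------------
-- Algebra of matrices and vectors

mat-cong : ∀ {a b c d a′ b′ c′ d′} →
  a ≡ a′ → b ≡ b′ → c ≡ c′ → d ≡ d′ → mat a b c d ≡ mat a′ b′ c′ d′
mat-cong refl refl refl refl = refl

+ᴹ-assoc : ∀ X Y Z → (X +ᴹ Y) +ᴹ Z ≡ X +ᴹ (Y +ᴹ Z)
+ᴹ-assoc (mat a b c d) (mat a′ b′ c′ d′) (mat a″ b″ c″ d″) =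
  mat-cong (+-assoc a a′ a″) (+-assoc b b′ b″) (+-assoc c c′ c″) (+-assoc d d′ d″)

+ᴹ-identityʳ : ∀ X → X +ᴹ 0ᴹ ≡ X
+ᴹ-identityʳ (mat a b c d) =
  mat-cong (+-identityʳ a) (+-identityʳ b) (+-identityʳ c) (+-identityʳ d)

+ᴹ-cancelˡ : ∀ X {Y Z} → X +ᴹ Y ≡ X +ᴹ Z → Y ≡ Z
+ᴹ-cancelˡ X {Y} {Z} eq =
  trans (sym (retract X Y)) (trans (cong (-ᴹ X +ᴹ_) eq) (retract X Z))
  where
  entry : ∀ x y → - x + (x + y) ≡ y
  entry = solve-∀
  retract : ∀ X Y → -ᴹ X +ᴹ (X +ᴹ Y) ≡ Y
  retract (mat a b c d) (mat a′ b′ c′ d′) =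
    mat-cong (entry a a′) (entry b b′) (entry c c′) (entry d d′)

+ᴹ-cancelʳ : ∀ X {Y Z} → Y +ᴹ X ≡ Z +ᴹ X → Y ≡ Z
+ᴹ-cancelʳ X {Y} {Z} eq =
  trans (sym (retract X Y)) (trans (cong (_+ᴹ -ᴹ X) eq) (retract X Z))
  where
  entry : ∀ x y → (y + x) + - x ≡ y
  entry = solve-∀
  retract : ∀ X Y → (Y +ᴹ X) +ᴹ -ᴹ X ≡ Y
  retract (mat a b c d) (mat a′ b′ c′ d′) =
    mat-cong (entry a a′) (entry b b′) (entry c c′) (entry d d′)

+ᴹ-undo : ∀ X Y → X ≡ (X +ᴹ Y) +ᴹ -ᴹ Y
+ᴹ-undo (mat a b c d) (mat a′ b′ c′ d′) =
  mat-cong (entry a a′) (entry b b′) (entry c c′) (entry d d′)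
  where
  entry : ∀ x y → x ≡ (x + y) + - y
  entry = solve-∀

+ᴹ-swapʳ : ∀ X Y Z → (X +ᴹ Y) +ᴹ Z ≡ (X +ᴹ Z) +ᴹ Y
+ᴹ-swapʳ (mat a b c d) (mat a′ b′ c′ d′) (mat a″ b″ c″ d″) =
  mat-cong (entry a a′ a″) (entry b b′ b″) (entry c c′ c″) (entry d d′ d″)
  where
  entry : ∀ x y z → (x + y) + z ≡ (x + z) + y
  entry = solve-∀

*ᴹ-distribʳ-+ᴹ : ∀ Z X Y → (X +ᴹ Y) *ᴹ Z ≡ X *ᴹ Z +ᴹ Y *ᴹ Z
*ᴹ-distribʳ-+ᴹ (mat a″ b″ c″ d″) (mat a b c d) (mat a′ b′ c′ d′) =
  mat-cong (entry a b a′ b′ a″ c″) (entry a b a′ b′ b″ d″)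
           (entry c d c′ d′ a″ c″) (entry c d c′ d′ b″ d″)
  where
  entry : ∀ a b a′ b′ x y →
    (a + a′) * x + (b + b′) * y ≡ (a * x + b * y) + (a′ * x + b′ * y)
  entry = solve-∀

*ᵛ-distribʳ-+ᴹ : ∀ X Y v → (X +ᴹ Y) *ᵛ v ≡ X *ᵛ v +ᵛ Y *ᵛ v
*ᵛ-distribʳ-+ᴹ (mat a b c d) (mat a′ b′ c′ d′) (x , y) =
  cong₂ _,_ (entry a b a′ b′ x y) (entry c d c′ d′ x y)
  where
  entry : ∀ a b a′ b′ x y →
    (a + a′) * x + (b + b′) * y ≡ (a * x + b * y) + (a′ * x + b′ * y)
  entry = solve-∀

*ᵛ-assoc : ∀ X Y v → X *ᵛ (Y *ᵛ v) ≡ (X *ᴹ Y) *ᵛ v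
*ᵛ-assoc (mat a b c d) (mat a′ b′ c′ d′) (x , y) =
  cong₂ _,_ (entry a b a′ b′ c′ d′ x y) (entry c d a′ b′ c′ d′ x y)
  where
  entry : ∀ a b a′ b′ c′ d′ x y →
    a * (a′ * x + b′ * y) + b * (c′ * x + d′ * y) ≡
    (a * a′ + b * c′) * x + (a * b′ + b * d′) * y
  entry = solve-∀

+ᵛ-assoc : ∀ x y z → (x +ᵛ y) +ᵛ z ≡ x +ᵛ (y +ᵛ z)
+ᵛ-assoc (a , b) (a′ , b′) (a″ , b″) = cong₂ _,_ (+-assoc a a′ a″) (+-assoc b b′ b″)

+ᵛ-cancelˡ : ∀ x {y z} → x +ᵛ y ≡ x +ᵛ z → y ≡ z
+ᵛ-cancelˡ x {y} {z} eq =
  trans (sym (retract x y)) (trans (cong (neg x +ᵛ_) eq) (retract x z))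
  where
  neg : Vec² → Vec²
  neg (a , b) = (- a , - b)
  entry : ∀ x y → - x + (x + y) ≡ y
  entry = solve-∀
  retract : ∀ x y → neg x +ᵛ (x +ᵛ y) ≡ y
  retract (a , b) (a′ , b′) = cong₂ _,_ (entry a a′) (entry b b′)

------------------------------------------------------------------------
-- Directions

oppositeDirection : Direction → Direction
oppositeDirection d₁ = d₅
oppositeDirection d₂ = d₆
oppositeDirection d₃ = d₇
oppositeDirection d₄ = d₈
oppositeDirection d₅ = d₁
oppositeDirection d₆ = d₂
oppositeDirection d₇ = d₃
oppositeDirection d₈ = d₄

directionMatrix-opposite : ∀ i →
  directionMatrix (oppositeDirection i) ≡ -ᴹ directionMatrix i
directionMatrix-opposite = λ
  { d₁ → refl ; d₂ → refl ; d₃ → refl ; d₄ → refl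
  ; d₅ → refl ; d₆ → refl ; d₇ → refl ; d₈ → refl }

-- A left inverse of directionMatrix; its values off the direction
-- matrices are arbitrary.
directionOf : Matrix → Direction
directionOf (mat (+ 1)    _     _     (+ 1)) = d₂
directionOf (mat (+ 1)    _     _     _)     = d₇
directionOf (mat -[1+ 0 ] _     _     (+ 1)) = d₃
directionOf (mat -[1+ 0 ] _     _     _)     = d₆
directionOf (mat _        (+ 1) (+ 1) _)     = d₁
directionOf (mat _        (+ 1) _     _)     = d₈
directionOf (mat _        _     (+ 1) _)     = d₄
directionOf _                                = d₅

directionOf-directionMatrix : ∀ i → directionOf (directionMatrix i) ≡ i
directionOf-directionMatrix = λ
  { d₁ → refl ; d₂ → refl ; d₃ → refl ; d₄ → refl
  ; d₅ → refl ; d₆ → refl ; d₇ → refl ; d₈ → refl }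

directionMatrix-injective : ∀ {i j} → directionMatrix i ≡ directionMatrix j → i ≡ j
directionMatrix-injective {i} {j} eq =
  trans (sym (directionOf-directionMatrix i))
        (trans (cong directionOf eq) (directionOf-directionMatrix j))

------------------------------------------------------------------------
-- Potentials of labelled graphs

-- A potential assigns to every vertex a matrix so that arcs are exactly
-- the pairs of vertices whose matrices differ by a direction matrix, the
-- one that belongs to the label of the arc.  Distances are then differences
-- of matrices.
record Potential (Φ : LabelledGraph) : Set where
  open LabelledGraph Φ
  field
    position  : Vertex → Matrix
    injective : ∀ {x y} → position x ≡ position y → x ≡ y
    arc⇔      : ∀ {x y i} → Arc x y i ⇔ position y ≡ position x +ᴹ directionMatrix i

module _ {Φ : LabelledGraph} (V : Potential Φ) where
  open LabelledGraph Φ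
  open Potential V
  private
    module Arc⇔ {x y i} = Equivalence (arc⇔ {x} {y} {i})

  position-walk : ∀ {x y} (w : Walk x y) → position y ≡ position x +ᴹ total w
  position-walk {x} ε = sym (+ᴹ-identityʳ (position x))
  position-walk {x} {y} (_◅_ {j = z} (i , a) w) = begin
    position y                                     ≡⟨ position-walk w ⟩
    position z +ᴹ total w                          ≡⟨ cong (_+ᴹ total w) (Arc⇔.to a) ⟩
    position x +ᴹ directionMatrix i +ᴹ total w     ≡⟨ +ᴹ-assoc (position x) _ _ ⟩
    position x +ᴹ (directionMatrix i +ᴹ total w)   ∎
    where open ≡-Reasoning

  position-distance : ∀ {x y D} → Distance x y D → position y ≡ position x +ᴹ D
  position-distance (w , refl) = position-walk w

  -- In a connected graph the difference of two positions is a distance.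
  distance-connected : Connected underlying → ∀ {x y D} →
    position y ≡ position x +ᴹ D → Distance x y D
  distance-connected connected {x} {y} eq =
    w , +ᴹ-cancelˡ (position x) (trans (sym (position-walk w)) eq)
    where w = connected x y

  closed-total : ∀ {x} (w : Walk x x) → total w ≡ 0ᴹ
  closed-total {x} w = +ᴹ-cancelˡ (position x)
    (trans (sym (position-walk w)) (sym (+ᴹ-identityʳ (position x))))

  arc-reverse : ∀ {x y i} → Arc x y i → Arc y x (oppositeDirection i)
  arc-reverse {x} {y} {i} a = Arc⇔.from (begin
    position x
      ≡⟨ +ᴹ-undo (position x) (directionMatrix i) ⟩
    position x +ᴹ directionMatrix i +ᴹ -ᴹ directionMatrix i
      ≡⟨ cong₂ _+ᴹ_ (Arc⇔.to a) (directionMatrix-opposite i) ⟨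
    position y +ᴹ directionMatrix (oppositeDirection i)
      ∎)
    where open ≡-Reasoning

  isDirectionGraph : IsDirectionGraph Φ
  isDirectionGraph = record
    { symmetric   = λ a → _ , arc-reverse a
    ; labelUnique = λ {x} a b → directionMatrix-injective
        (+ᴹ-cancelˡ (position x) (trans (sym (Arc⇔.to a)) (Arc⇔.to b)))
    ; cycleTotal  = λ w _ → closed-total w
    }

  coherent : Coherent
  coherent {x} {y} {D} δ =
      mk⇔ (λ D≡0 → injective (sym (trans (trans eq (cong (position x +ᴹ_) D≡0))
                                         (+ᴹ-identityʳ (position x)))))
          (λ { refl → +ᴹ-cancelˡ (position x)
                        (trans (sym eq) (sym (+ᴹ-identityʳ (position x)))) })
    , mk⇔ (λ (i , D≡i) → i , Arc⇔.from (trans eq (cong (position x +ᴹ_) D≡i)))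
          (λ (i , a) → i , +ᴹ-cancelˡ (position x) (trans (sym eq) (Arc⇔.to a)))
    where
    eq : position y ≡ position x +ᴹ D
    eq = position-distance δ

-- Composing a potential with an additive map F of matrices that has a left
-- inverse G, and that permutes the direction matrices as π permutes the
-- directions, gives a potential of the relabelled graph.
relabelPotential : ∀ {Φ} (π : Permutation′ 8) (F G : Matrix → Matrix) →
  (∀ X → G (F X) ≡ X) → (∀ X Y → F (X +ᴹ Y) ≡ F X +ᴹ F Y) →
  (∀ i → F (directionMatrix i) ≡ directionMatrix (π ⟨$⟩ʳ i)) →
  Potential Φ → Potential (relabel π Φ)
relabelPotential {Φ} π F G retract additive compatible V = record
  { position  = F ∘ position
  ; injective = injective ∘ F-injective
  ; arc⇔      = mk⇔ to′ from′
  }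
  where
  open LabelledGraph Φ
  open Potential V
  open ≡-Reasoning
  F-injective : ∀ {X Y} → F X ≡ F Y → X ≡ Y
  F-injective {X} {Y} eq = trans (sym (retract X)) (trans (cong G eq) (retract Y))

  step : ∀ X i → F (X +ᴹ directionMatrix i) ≡ F X +ᴹ directionMatrix (π ⟨$⟩ʳ i)
  step X i = trans (additive X (directionMatrix i)) (cong (F X +ᴹ_) (compatible i))

  to′ : ∀ {x y j} → ∃[ i ] (Arc x y i × π ⟨$⟩ʳ i ≡ j) →
        F (position y) ≡ F (position x) +ᴹ directionMatrix j
  to′ {x} (i , a , refl) =
    trans (cong F (Equivalence.to arc⇔ a)) (step (position x) i)

  from′ : ∀ {x y j} → F (position y) ≡ F (position x) +ᴹ directionMatrix j →
          ∃[ i ] (Arc x y i × π ⟨$⟩ʳ i ≡ j)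
  from′ {x} {y} {j} eq = i , Equivalence.from arc⇔ (F-injective eq′) , inverseʳ π
    where
    i = π ⟨$⟩ˡ j
    eq′ : F (position y) ≡ F (position x +ᴹ directionMatrix i)
    eq′ = begin
      F (position y)                                ≡⟨ eq ⟩
      F (position x) +ᴹ directionMatrix j
        ≡⟨ cong (λ k → F (position x) +ᴹ directionMatrix k) (inverseʳ π) ⟨
      F (position x) +ᴹ directionMatrix (π ⟨$⟩ʳ i)  ≡⟨ step (position x) i ⟨
      F (position x +ᴹ directionMatrix i)           ∎

pullbackPotential : ∀ {Φ Ψ} → Φ ≅ Ψ → Potential Ψ → Potential Φ
pullbackPotential iso V = record
  { position  = V.position ∘ to
  ; injective = λ eq → trans (sym (strictlyInverseʳ _))
                         (trans (cong from (V.injective eq)) (strictlyInverseʳ _))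
  ; arc⇔      = mk⇔ (Equivalence.to V.arc⇔ ∘ Equivalence.to arcs)
                    (Equivalence.from arcs ∘ Equivalence.from V.arc⇔)
  }
  where
  module V = Potential V
  open _≅_ iso
  open Inverse bijection using (to; from; strictlyInverseʳ)

------------------------------------------------------------------------
-- Isomorphisms of digraphs

isomorphism-sym : ∀ {G H} → Isomorphism G H → Isomorphism H G
isomorphism-sym {G} {H} iso = record
  { bijection = ↔-sym bijection
  ; edges     = λ {x} {y} → mk⇔
      (λ e → Equivalence.from edges
        (subst₂ H.Edge (sym (strictlyInverseˡ x)) (sym (strictlyInverseˡ y)) e))
      (λ e → subst₂ H.Edge (strictlyInverseˡ x) (strictlyInverseˡ y)
        (Equivalence.to edges e))
  }
  where
  module H = Digraph H
  open Isomorphism iso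
  open Inverse bijection using (strictlyInverseˡ)

isomorphism-trans : ∀ {G H K} → Isomorphism G H → Isomorphism H K → Isomorphism G K
isomorphism-trans f g = record
  { bijection = ↔-trans f.bijection g.bijection
  ; edges     = mk⇔ (Equivalence.to g.edges ∘ Equivalence.to f.edges)
                    (Equivalence.from f.edges ∘ Equivalence.from g.edges)
  }
  where
  module f = Isomorphism f
  module g = Isomorphism g

connected-respects : ∀ {G H} → Isomorphism G H → Connected G → Connected H
connected-respects {G} {H} iso connected x y =
  subst₂ (Star H.Edge) (strictlyInverseˡ x) (strictlyInverseˡ y)
    (gmap to (Equivalence.to edges) (connected (from x) (from y)))
  where
  module H = Digraph H
  open Isomorphism iso
  open Inverse bijection using (to; from; strictlyInverseˡ)

≅⇒isomorphism : ∀ {Φ Ψ} → Φ ≅ Ψ →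
  Isomorphism (LabelledGraph.underlying Φ) (LabelledGraph.underlying Ψ)
≅⇒isomorphism iso = record
  { bijection = bijection
  ; edges     = mk⇔ (λ (i , a) → i , Equivalence.to arcs a)
                    (λ (i , a) → i , Equivalence.from arcs a)
  }
  where open _≅_ iso

relabel-isomorphism : ∀ π Φ →
  Isomorphism (LabelledGraph.underlying Φ) (LabelledGraph.underlying (relabel π Φ))
relabel-isomorphism π Φ = record
  { bijection = ↔-refl
  ; edges     = mk⇔ (λ (i , a) → π ⟨$⟩ʳ i , i , a , refl)
                    (λ (_ , i , a , _) → i , a)
  }

------------------------------------------------------------------------
-- Duality

-- The arcs of Φ′ labelled i, transported to Φ by η, are the pairs of
-- vertices at distance directionMatrix i *ᴹ A.  Besides the condition on
-- distances in a dual direction graph this contains its converse, which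
-- identifies Φ′ with the graph of the second leaper.
Dualizes : ∀ {Φ Φ′} → Potential Φ → Matrix →
  LabelledGraph.Vertex Φ ↔ LabelledGraph.Vertex Φ′ → Set
Dualizes {Φ} {Φ′} V A η = ∀ a b i →
  LabelledGraph.Arc Φ′ (to a) (to b) i ⇔ position b ≡ position a +ᴹ directionMatrix i *ᴹ A
  where
  open Potential V
  open Inverse η using (to)

isDual : ∀ {Φ Φ′ A} (V : Potential Φ) → Potential Φ′ →
  Connected (LabelledGraph.underlying Φ) →
  Isomorphism (LabelledGraph.underlying Φ) (LabelledGraph.underlying Φ′) →
  (∀ i → A ≢ directionMatrix i) →
  ∀ η → Dualizes {Φ} {Φ′} V A η → IsDual Φ Φ′ A
isDual V V′ connected iso A-new η dualizes = record
  { isDirectionGraph  = isDirectionGraph V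
  ; isDirectionGraph′ = isDirectionGraph V′
  ; notDirection      = A-new
  ; coherent          = coherent V
  ; coherent′         = coherent V′
  ; connected         = connected
  ; connected′        = connected-respects iso connected
  ; isomorphic        = iso
  ; η                 = η
  ; distance          = λ {a} {b} {i} arc →
      distance-connected V connected (Equivalence.to (dualizes a b i) arc)
  }

-- The positions in Φ′, multiplied by A on the right, may differ from those
-- in Φ by a translation.  The matrix A⁻¹ is a right inverse of A.
dualizes-affine : ∀ {Φ Φ′} (V : Potential Φ) (V′ : Potential Φ′) (A A⁻¹ C : Matrix) →
  (∀ X → X *ᴹ A *ᴹ A⁻¹ ≡ X) →
  (η : LabelledGraph.Vertex Φ ↔ LabelledGraph.Vertex Φ′) →
  (∀ a → Potential.position V′ (Inverse.to η a) *ᴹ A ≡ Potential.position V a +ᴹ C) →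
  Dualizes {Φ} {Φ′} V A η
dualizes-affine V V′ A A⁻¹ C retract η affine a b i = mk⇔
  (λ arc → +ᴹ-cancelʳ C (trans (sym (affine b))
    (trans (cong (_*ᴹ A) (Equivalence.to V′.arc⇔ arc)) sides)))
  (λ eq → Equivalence.from V′.arc⇔ (*A-injective
    (trans (trans (affine b) (cong (_+ᴹ C) eq)) (sym sides))))
  where
  module V = Potential V
  module V′ = Potential V′
  open Inverse η using (to)
  open ≡-Reasoning
  *A-injective : ∀ {X Y} → X *ᴹ A ≡ Y *ᴹ A → X ≡ Y
  *A-injective {X} {Y} eq =
    trans (sym (retract X)) (trans (cong (_*ᴹ A⁻¹) eq) (retract Y))
  D = directionMatrix i
  sides : (V′.position (to a) +ᴹ D) *ᴹ A ≡ (V.position a +ᴹ D *ᴹ A) +ᴹ C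
  sides = begin
    (V′.position (to a) +ᴹ D) *ᴹ A       ≡⟨ *ᴹ-distribʳ-+ᴹ A (V′.position (to a)) D ⟩
    V′.position (to a) *ᴹ A +ᴹ D *ᴹ A    ≡⟨ cong (_+ᴹ D *ᴹ A) (affine a) ⟩
    (V.position a +ᴹ C) +ᴹ D *ᴹ A        ≡⟨ +ᴹ-swapʳ (V.position a) C (D *ᴹ A) ⟩
    (V.position a +ᴹ D *ᴹ A) +ᴹ C        ∎

------------------------------------------------------------------------
-- Positions of the squares of the pinwheel

-- A square is given by the quarter k of the pinwheel that contains it, 0F to
-- 3F for the boards I to IV, and by integers u and v: turned back into the
-- quarter I it is centered at ((p + q) / 2 + 2qu , (p - q) / 2 + 2qv).
Coordinates : Set
Coordinates = Fin 4 × Vec²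

next : Fin 4 → Fin 4
next 0F = 1F
next 1F = 2F
next 2F = 3F
next 3F = 0F

previous : Fin 4 → Fin 4
previous 0F = 3F
previous 1F = 0F
previous 2F = 1F
previous 3F = 2F

next-previous : ∀ k → next (previous k) ≡ k
next-previous = λ { 0F → refl ; 1F → refl ; 2F → refl ; 3F → refl }

-- With the center of the square written as Z (p , q), this is the matrix
-- Z - Z₀ where Z₀ has all entries 1/2.  Subtracting Z₀ makes the entries
-- integers.
positionMatrix : Coordinates → Matrix
positionMatrix (0F , u , v) = mat 0ℤ  (+ 2 * u)
                                  0ℤ  (+ 2 * v - 1ℤ)
positionMatrix (1F , u , v) = mat -1ℤ (- (+ 2 * v))
                                  0ℤ  (+ 2 * u)
positionMatrix (2F , u , v) = mat -1ℤ (- (+ 2 * u) - 1ℤ)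
                                  -1ℤ (- (+ 2 * v))
positionMatrix (3F , u , v) = mat 0ℤ  (+ 2 * v - 1ℤ)
                                  -1ℤ (- (+ 2 * u) - 1ℤ)

-- The counterclockwise rotation of Z by 90°, written in terms of Z - Z₀.
turn : Matrix → Matrix
turn (mat a b c d) = mat (- c - 1ℤ) (- d - 1ℤ)
                         a          b

positionMatrix-next : ∀ k w → positionMatrix (next k , w) ≡ turn (positionMatrix (k , w))
positionMatrix-next 0F (u , v) = mat-cong refl (entry v) refl refl
  where
  entry : ∀ v → - (+ 2 * v) ≡ - (+ 2 * v - 1ℤ) - 1ℤ
  entry = solve-∀
positionMatrix-next 1F (u , v) = refl
positionMatrix-next 2F (u , v) = mat-cong refl (entry v) refl refl
  where
  entry : ∀ v → + 2 * v - 1ℤ ≡ - (- (+ 2 * v)) - 1ℤ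
  entry = solve-∀
positionMatrix-next 3F (u , v) = mat-cong refl (entry u) refl refl
  where
  entry : ∀ u → + 2 * u ≡ - (- (+ 2 * u) - 1ℤ) - 1ℤ
  entry = solve-∀

-- The quarter can be read off from the signs in the first column.
quarterOf : Matrix → Fin 4
quarterOf (mat (+ _)    _ (+ _)    _) = 0F
quarterOf (mat -[1+ _ ] _ (+ _)    _) = 1F
quarterOf (mat -[1+ _ ] _ -[1+ _ ] _) = 2F
quarterOf (mat (+ _)    _ -[1+ _ ] _) = 3F

quarterOf-positionMatrix : ∀ k w → quarterOf (positionMatrix (k , w)) ≡ k
quarterOf-positionMatrix = λ
  { 0F w → refl ; 1F w → refl ; 2F w → refl ; 3F w → refl }

positionMatrix-injective : ∀ {x y} → positionMatrix x ≡ positionMatrix y → x ≡ y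
positionMatrix-injective {k , w} {l , z} eq with k≡l
  where
  k≡l : k ≡ l
  k≡l = trans (sym (quarterOf-positionMatrix k w))
          (trans (cong quarterOf eq) (quarterOf-positionMatrix l z))
... | refl = cong (k ,_) (same k eq)
  where
  double-injective : ∀ {x y} → + 2 * x ≡ + 2 * y → x ≡ y
  double-injective = *-cancelˡ-≡ (+ 2) _ _
  entry : ∀ x → + 2 * x - 1ℤ + 1ℤ ≡ + 2 * x
  entry = solve-∀
  first : ∀ {w z} → positionMatrix (0F , w) ≡ positionMatrix (0F , z) → w ≡ z
  first {u , v} {u′ , v′} eq = cong₂ _,_
    (double-injective (cong Matrix.m₁₂ eq))
    (double-injective (trans (sym (entry v))
      (trans (cong ((_+ 1ℤ) ∘ Matrix.m₂₂) eq) (entry v′))))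
  backwards : ∀ k {w z} → (positionMatrix (next k , w) ≡ positionMatrix (next k , z) → w ≡ z) →
    positionMatrix (k , w) ≡ positionMatrix (k , z) → w ≡ z
  backwards k {w} {z} f eq = f (trans (positionMatrix-next k w)
    (trans (cong turn eq) (sym (positionMatrix-next k z))))
  same : ∀ k {w z} → positionMatrix (k , w) ≡ positionMatrix (k , z) → w ≡ z
  same 0F = first
  same 1F = backwards 1F (backwards 2F (backwards 3F first))
  same 2F = backwards 2F (backwards 3F first)
  same 3F = backwards 3F first

------------------------------------------------------------------------
-- Steps between squares of neighbouring quarters

-- The positions of x and y differ by a direction matrix.
record Step (x y : Coordinates) : Set where
  constructor step
  field
    direction : Direction
    equation  : positionMatrix y ≡ positionMatrix x +ᴹ directionMatrix direction

-- The direction of a move after a counterclockwise rotation by 90°.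
turnDirection : Direction → Direction
turnDirection d₁ = d₃
turnDirection d₂ = d₄
turnDirection d₃ = d₅
turnDirection d₄ = d₆
turnDirection d₅ = d₇
turnDirection d₆ = d₈
turnDirection d₇ = d₁
turnDirection d₈ = d₂

turn-+ᴹ : ∀ X i → turn (X +ᴹ directionMatrix i) ≡ turn X +ᴹ directionMatrix (turnDirection i)
turn-+ᴹ (mat a b c d) i =
  trans (turn-linear (directionMatrix i)) (cong (turn (mat a b c d) +ᴹ_) (sym (rotate-direction i)))
  where
  rotate : Matrix → Matrix
  rotate (mat a b c d) = mat (- c) (- d) a b
  rotate-direction : ∀ i → directionMatrix (turnDirection i) ≡ rotate (directionMatrix i)
  rotate-direction = λ
    { d₁ → refl ; d₂ → refl ; d₃ → refl ; d₄ → refl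
    ; d₅ → refl ; d₆ → refl ; d₇ → refl ; d₈ → refl }
  entry : ∀ x y → - (x + y) - 1ℤ ≡ - x - 1ℤ + - y
  entry = solve-∀
  turn-linear : ∀ Y → turn (mat a b c d +ᴹ Y) ≡ turn (mat a b c d) +ᴹ rotate Y
  turn-linear (mat a′ b′ c′ d′) = mat-cong (entry c c′) (entry d d′) refl refl

step-next : ∀ {k l w z} → Step (k , w) (l , z) → Step (next k , w) (next l , z)
step-next {k} {l} {w} {z} (step i eq) = step (turnDirection i)
  (trans (positionMatrix-next l z) (trans (cong turn eq)
    (trans (turn-+ᴹ (positionMatrix (k , w)) i)
      (cong (_+ᴹ directionMatrix (turnDirection i)) (sym (positionMatrix-next k w))))))

step-sym : ∀ {x y} → Step x y → Step y x
step-sym {x} {y} (step i eq) = step (oppositeDirection i)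
  (trans (+ᴹ-undo (positionMatrix x) (directionMatrix i))
    (cong₂ _+ᴹ_ (sym eq) (sym (directionMatrix-opposite i))))

-- A step from the first to the second quarter, rotated k times.
step-any : ∀ k {w z} → Step (0F , w) (1F , z) → Step (k , w) (next k , z)
step-any 0F s = s
step-any 1F s = step-next s
step-any 2F s = step-next (step-next s)
step-any 3F s = step-next (step-next (step-next s))

-- There are two steps to the next quarter, and two steps back.  Four steps A⁺
-- in a row lead back to the start, and so do four steps B⁺; A⁻ and B⁻ are the
-- inverses of A⁺ and B⁺.
step-A⁺ : ∀ k u v → Step (k , u , v) (next k , v , - u)
step-A⁺ k u v = step-any k (step d₃ (mat-cong refl (entry₁ u) refl (entry₂ v)))
  where
  entry₁ : ∀ u → - (+ 2 * - u) ≡ + 2 * u + 0ℤ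
  entry₁ = solve-∀
  entry₂ : ∀ v → + 2 * v ≡ + 2 * v - 1ℤ + 1ℤ
  entry₂ = solve-∀

step-B⁺ : ∀ k u v → Step (k , u , v) (next k , v - 1ℤ , - u)
step-B⁺ k u v = step-any k (step d₆ (mat-cong refl (entry₁ u) refl (entry₂ v)))
  where
  entry₁ : ∀ u → - (+ 2 * - u) ≡ + 2 * u + 0ℤ
  entry₁ = solve-∀
  entry₂ : ∀ v → + 2 * (v - 1ℤ) ≡ + 2 * v - 1ℤ + -1ℤ
  entry₂ = solve-∀

step-A⁻ : ∀ k u v → Step (k , u , v) (previous k , - v , u)
step-A⁻ k u v = step-sym (subst₂ (λ l z → Step (previous k , - v , u) (l , u , z))
  (next-previous k) (neg-involutive v) (step-A⁺ (previous k) (- v) u))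

step-B⁻ : ∀ k u v → Step (k , u , v) (previous k , - v , u + 1ℤ)
step-B⁻ k u v = step-sym (subst₂ (λ l z → Step (previous k , - v , u + 1ℤ) (l , z))
  (next-previous k) (cong₂ _,_ (entry u) (neg-involutive v))
  (step-B⁺ (previous k) (- v) (u + 1ℤ)))
  where
  entry : ∀ u → u + 1ℤ - 1ℤ ≡ u
  entry = solve-∀

------------------------------------------------------------------------
-- The direction graph of the pinwheel

-- The rectangle that cuts out the first quarter: - d ≤ u + v ≤ n + d and
-- 1 - n - d ≤ v - u ≤ n + d.  Each bound says that a slack is nonnegative,
-- so that bounds can be added and compared by ring identities.
record Region (n d : ℕ) (w : Vec²) : Set where
  constructor region
  private
    u = proj₁ w
    v = proj₂ w
    N = + n
    D = + d
  field
    sum-lower        : 0ℤ ≤ D + (u + v)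
    sum-upper        : 0ℤ ≤ N + D - (u + v)
    difference-lower : 0ℤ ≤ N + D - 1ℤ + (v - u)
    difference-upper : 0ℤ ≤ N + D - (v - u)

-- The direction graph that is extracted from the board of every leaper.
pinwheelGraph : ℕ → ℕ → LabelledGraph
pinwheelGraph n d = record
  { Vertex = Refinement Coordinates (λ (_ , w) → Region n d w)
  ; Arc    = λ x y i → positionMatrix (value y) ≡ positionMatrix (value x) +ᴹ directionMatrix i
  }

pinwheelPotential : ∀ n d → Potential (pinwheelGraph n d)
pinwheelPotential n d = record
  { position  = λ x → positionMatrix (value x)
  ; injective = λ eq → value-injective (positionMatrix-injective eq)
  ; arc⇔      = mk⇔ (λ a → a) (λ a → a)
  }

------------------------------------------------------------------------
-- Connectedness

0≤-+ : ∀ {x y} → 0ℤ ≤ x → 0ℤ ≤ y → 0ℤ ≤ x + y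
0≤-+ = +-mono-≤

0≤-resp : ∀ {x y} → y ≡ x → 0ℤ ≤ x → 0ℤ ≤ y
0≤-resp refl p = p

module _ {n d : ℕ} where
  private
    N = + n
    D = + d
    n≥0 : 0ℤ ≤ N
    n≥0 = +≤+ z≤n

  region-A⁺ : 0 ℕ.< n → ∀ {u v} → Region n d (u , v) →
    0ℤ ≤ D + (v - u) → 0ℤ ≤ N + D - 1ℤ - (u + v) → Region n d (v , - u)
  region-A⁺ _ {u} {v} (region s⁻ s⁺ t⁻ t⁺) p q = region
    p
    t⁺
    (0≤-resp (e₁ N D u v) q)
    (0≤-resp (e₂ N D u v) (0≤-+ n≥0 s⁻))
    where
    e₁ : ∀ N D u v → N + D - 1ℤ + (- u - v) ≡ N + D - 1ℤ - (u + v)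
    e₁ = solve-∀
    e₂ : ∀ N D u v → N + D - (- u - v) ≡ N + (D + (u + v))
    e₂ = solve-∀

  region-B⁺ : 0 ℕ.< n → ∀ {u v} → Region n d (u , v) →
    0ℤ ≤ D + (v - u) - 1ℤ → Region n d (v - 1ℤ , - u)
  region-B⁺ n>0 {u} {v} (region s⁻ s⁺ t⁻ t⁺) p = region
    (0≤-resp (e₁ D u v) p)
    (0≤-resp (e₂ N D u v) (0≤-+ t⁺ (+≤+ (z≤n {1}))))
    (0≤-resp (e₃ N D u v) s⁺)
    (0≤-resp (e₄ N D u v) (0≤-+ (i≤j⇒0≤j-i (+≤+ n>0)) s⁻))
    where
    e₁ : ∀ D u v → D + (v - 1ℤ + - u) ≡ D + (v - u) - 1ℤ
    e₁ = solve-∀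
    e₂ : ∀ N D u v → N + D - (v - 1ℤ + - u) ≡ N + D - (v - u) + 1ℤ
    e₂ = solve-∀
    e₃ : ∀ N D u v → N + D - 1ℤ + (- u - (v - 1ℤ)) ≡ N + D - (u + v)
    e₃ = solve-∀
    e₄ : ∀ N D u v → N + D - (- u - (v - 1ℤ)) ≡ (N - 1ℤ) + (D + (u + v))
    e₄ = solve-∀

  region-A⁻ : 0 ℕ.< n → ∀ {u v} → Region n d (u , v) →
    0ℤ ≤ D - (v - u) → Region n d (- v , u)
  region-A⁻ n>0 {u} {v} (region s⁻ s⁺ t⁻ t⁺) p = region
    (0≤-resp (e₁ D u v) p)
    (0≤-resp (e₂ N D u v) (0≤-+ t⁻ (+≤+ (z≤n {1}))))
    (0≤-resp (e₃ N D u v) (0≤-+ (i≤j⇒0≤j-i (+≤+ n>0)) s⁻))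
    (0≤-resp (e₄ N D u v) s⁺)
    where
    e₁ : ∀ D u v → D + (- v + u) ≡ D - (v - u)
    e₁ = solve-∀
    e₂ : ∀ N D u v → N + D - (- v + u) ≡ N + D - 1ℤ + (v - u) + 1ℤ
    e₂ = solve-∀
    e₃ : ∀ N D u v → N + D - 1ℤ + (u - - v) ≡ (N - 1ℤ) + (D + (u + v))
    e₃ = solve-∀
    e₄ : ∀ N D u v → N + D - (u - - v) ≡ N + D - (u + v)
    e₄ = solve-∀

  region-B⁻ : ∀ {u v} → Region n d (u , v) →
    0ℤ ≤ D + 1ℤ - (v - u) → 0ℤ ≤ N + D - 1ℤ - (u + v) → Region n d (- v , u + 1ℤ)
  region-B⁻ {u} {v} (region s⁻ s⁺ t⁻ t⁺) p q = region
    (0≤-resp (e₁ D u v) p)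
    (0≤-resp (e₂ N D u v) t⁻)
    (0≤-resp (e₃ N D u v) (0≤-+ n≥0 s⁻))
    (0≤-resp (e₄ N D u v) q)
    where
    e₁ : ∀ D u v → D + (- v + (u + 1ℤ)) ≡ D + 1ℤ - (v - u)
    e₁ = solve-∀
    e₂ : ∀ N D u v → N + D - (- v + (u + 1ℤ)) ≡ N + D - 1ℤ + (v - u)
    e₂ = solve-∀
    e₃ : ∀ N D u v → N + D - 1ℤ + ((u + 1ℤ) - - v) ≡ N + (D + (u + v))
    e₃ = solve-∀
    e₄ : ∀ N D u v → N + D - ((u + 1ℤ) - - v) ≡ N + D - 1ℤ - (u + v)
    e₄ = solve-∀

-- zigzag z = ∣ 2z + 1/2 ∣ - 1/2.
zigzag : ℤ → ℕ
zigzag (+ m)    = m ℕ.+ m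
zigzag -[1+ m ] = suc (m ℕ.+ m)

-- For p = 0 and q = 1 the center of the square (0F , u , v) is the point
-- (2u + 1/2 , 2v - 1/2), and height is its taxicab norm minus 1.  The other
-- quarters are rotated copies, so the same holds for them.  A step changes one
-- coordinate of the center by 1.
height : Vec² → ℕ
height (u , v) = zigzag u ℕ.+ zigzag (- v)

private
  zigzag-neg : ∀ m → zigzag -[1+ m ] ℕ.< zigzag +[1+ m ]
  zigzag-neg m = s<s (ℕ.≤-reflexive (sym (ℕ.+-suc m m)))
  neg-succ : ∀ x → - (- (1ℤ + x) + 1ℤ) ≡ x
  neg-succ = solve-∀

height-A⁺ : ∀ u b → height (-[1+ b ] , - u) ℕ.< height (u , -[1+ b ])
height-A⁺ u b rewrite neg-involutive u | ℕ.+-comm (zigzag u) (zigzag +[1+ b ]) =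
  ℕ.+-monoˡ-< (zigzag u) (zigzag-neg b)

height-B⁺ : ∀ u b → height (+ b , - u) ℕ.< height (u , +[1+ b ])
height-B⁺ u b rewrite neg-involutive u | ℕ.+-comm (zigzag u) (zigzag -[1+ b ]) =
  ℕ.+-monoˡ-< (zigzag u) (ℕ.n<1+n (b ℕ.+ b))

height-A⁻ : ∀ a v → height (- v , +[1+ a ]) ℕ.< height (+[1+ a ] , v)
height-A⁻ a v rewrite ℕ.+-comm (zigzag (- v)) (zigzag -[1+ a ]) =
  ℕ.+-monoˡ-< (zigzag (- v)) (zigzag-neg a)

height-B⁻ : ∀ a v → height (- v , -[1+ a ] + 1ℤ) ℕ.< height (-[1+ a ] , v)
height-B⁻ a v rewrite neg-succ (+ a) | ℕ.+-comm (zigzag (- v)) (zigzag (+ a)) =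
  ℕ.+-monoˡ-< (zigzag (- v)) (ℕ.n<1+n (a ℕ.+ a))

module _ {n d : ℕ} (n>0 : 0 ℕ.< n) where
  open LabelledGraph (pinwheelGraph n d)
  private
    N = + n
    D = + d
    +≥0 : ∀ {m} → 0ℤ ≤ + m
    +≥0 = +≤+ z≤n
    N-1≥0 : 0ℤ ≤ N - 1ℤ
    N-1≥0 = i≤j⇒0≤j-i (+≤+ n>0)

  origin-region : Region n d (0ℤ , 0ℤ)
  origin-region = region +≥0 +≥0 (0≤-resp (e N D) (0≤-+ N-1≥0 (+≥0 {d}))) +≥0
    where
    e : ∀ N D → N + D - 1ℤ + 0ℤ ≡ (N - 1ℤ) + D
    e = solve-∀

  -- The four vertices (k , 0 , 0) form a cycle of steps A⁺.
  center₀ : Fin 4 → Vertex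
  center₀ k = (k , 0ℤ , 0ℤ) , [ origin-region ]

  infixr 5 _▸_
  _▸_ : ∀ {x y z : Vertex} → Step (value x) (value y) → Walk y z → Walk x z
  s ▸ w = (Step.direction s , Step.equation s) ◅ w

  around : ∀ k → Walk (center₀ k) (center₀ (next k))
  around k = step-A⁺ k 0ℤ 0ℤ ▸ ε

  aroundToZero : ∀ k → Walk (center₀ k) (center₀ 0F)
  aroundToZero 0F = ε
  aroundToZero 1F = around 1F ◅◅ around 2F ◅◅ around 3F
  aroundToZero 2F = around 2F ◅◅ around 3F
  aroundToZero 3F = around 3F

  -- From (u , v) other than (0 , 0) some step that lowers the height stays
  -- inside the region.
  descend : ∀ k u v .(r : Region n d (u , v)) → Acc ℕ._<_ (height (u , v)) →
            Walk ((k , u , v) , [ r ]) (center₀ 0F)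

  descend-A⁺ : ∀ k u b .(r : Region n d (u , -[1+ b ])) →
    .(0ℤ ≤ D + (-[1+ b ] - u)) → .(0ℤ ≤ N + D - 1ℤ - (u + -[1+ b ])) →
    Acc ℕ._<_ (height (u , -[1+ b ])) → Walk ((k , u , -[1+ b ]) , [ r ]) (center₀ 0F)
  descend-A⁺ k u b r p q (acc rs) = step-A⁺ k u -[1+ b ]
    ▸ descend (next k) -[1+ b ] (- u) (region-A⁺ n>0 r p q) (rs (height-A⁺ u b))

  descend-B⁺ : ∀ k u b .(r : Region n d (u , +[1+ b ])) →
    .(0ℤ ≤ D + (+[1+ b ] - u) - 1ℤ) →
    Acc ℕ._<_ (height (u , +[1+ b ])) → Walk ((k , u , +[1+ b ]) , [ r ]) (center₀ 0F)
  descend-B⁺ k u b r p (acc rs) = step-B⁺ k u +[1+ b ]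
    ▸ descend (next k) (+ b) (- u) (region-B⁺ n>0 r p) (rs (height-B⁺ u b))

  descend-A⁻ : ∀ k a v .(r : Region n d (+[1+ a ] , v)) →
    .(0ℤ ≤ D - (v - +[1+ a ])) →
    Acc ℕ._<_ (height (+[1+ a ] , v)) → Walk ((k , +[1+ a ] , v) , [ r ]) (center₀ 0F)
  descend-A⁻ k a v r p (acc rs) = step-A⁻ k +[1+ a ] v
    ▸ descend (previous k) (- v) +[1+ a ] (region-A⁻ n>0 r p) (rs (height-A⁻ a v))

  descend-B⁻ : ∀ k a v .(r : Region n d (-[1+ a ] , v)) →
    .(0ℤ ≤ D + 1ℤ - (v - -[1+ a ])) → .(0ℤ ≤ N + D - 1ℤ - (-[1+ a ] + v)) →
    Acc ℕ._<_ (height (-[1+ a ] , v)) → Walk ((k , -[1+ a ] , v) , [ r ]) (center₀ 0F)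
  descend-B⁻ k a v r p q (acc rs) = step-B⁻ k -[1+ a ] v
    ▸ descend (previous k) (- v) (-[1+ a ] + 1ℤ) (region-B⁻ r p q) (rs (height-B⁻ a v))

  private
    case-B⁺ : ∀ u b → 0ℤ ≤ - u → 0ℤ ≤ D + (+[1+ b ] - u) - 1ℤ
    case-B⁺ u b u≤0 = 0≤-resp (e D u (+ b)) (0≤-+ (0≤-+ (+≥0 {d}) (+≥0 {b})) u≤0)
      where
      e : ∀ D u w → D + ((1ℤ + w) - u) - 1ℤ ≡ D + w + - u
      e = solve-∀
    case-A⁻ : ∀ a v → 0ℤ ≤ - v → 0ℤ ≤ D - (v - +[1+ a ])
    case-A⁻ a v v≤0 = 0≤-resp (e D (+[1+ a ]) v) (0≤-+ (0≤-+ (+≥0 {d}) (+≥0 {suc a})) v≤0)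
      where
      e : ∀ D u v → D - (v - u) ≡ D + u + - v
      e = solve-∀

    case-B⁻₁ : ∀ u v → Region n d (u , v) → 0ℤ ≤ - v → 0ℤ ≤ D + 1ℤ - (v - u)
    case-B⁻₁ u v r v≤0 =
      0≤-resp (e D u v) (0≤-+ (0≤-+ (Region.sum-lower r) (+≥0 {1})) (0≤-+ v≤0 v≤0))
      where
      e : ∀ D u v → D + 1ℤ - (v - u) ≡ D + (u + v) + 1ℤ + (- v + - v)
      e = solve-∀
    case-B⁻₂ : ∀ u v → 0ℤ ≤ - u → 0ℤ ≤ - v → 0ℤ ≤ N + D - 1ℤ - (u + v)
    case-B⁻₂ u v u≤0 v≤0 =
      0≤-resp (e N D u v) (0≤-+ (0≤-+ N-1≥0 (+≥0 {d})) (0≤-+ u≤0 v≤0))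
      where
      e : ∀ N D u v → N + D - 1ℤ - (u + v) ≡ (N - 1ℤ) + D + (- u + - v)
      e = solve-∀

  descend k (+ 0)    (+ 0)    r _ = aroundToZero k
  descend k (+ 0)    +[1+ b ] r h = descend-B⁺ k (+ 0) b r (case-B⁺ (+ 0) b +≥0) h
  descend k -[1+ a ] +[1+ b ] r h = descend-B⁺ k -[1+ a ] b r (case-B⁺ -[1+ a ] b +≥0) h
  descend k +[1+ a ] (+ 0)    r h = descend-A⁻ k a (+ 0) r (case-A⁻ a (+ 0) +≥0) h
  descend k +[1+ a ] -[1+ b ] r h = descend-A⁻ k a -[1+ b ] r (case-A⁻ a -[1+ b ] +≥0) h
  descend k -[1+ a ] (+ 0)    r h = descend-B⁻ k a (+ 0) r
    (case-B⁻₁ -[1+ a ] (+ 0) r +≥0) (case-B⁻₂ -[1+ a ] (+ 0) +≥0 +≥0) h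
  descend k -[1+ a ] -[1+ b ] r h = descend-B⁻ k a -[1+ b ] r
    (case-B⁻₁ -[1+ a ] -[1+ b ] r +≥0) (case-B⁻₂ -[1+ a ] -[1+ b ] +≥0 +≥0) h
  descend k (+ 0)    -[1+ b ] r h = descend-A⁺ k (+ 0) b r
    (0≤-resp (e D -[1+ b ]) (Region.sum-lower r)) (case-B⁻₂ (+ 0) -[1+ b ] +≥0 +≥0) h
    where
    e : ∀ D v → D + (v - 0ℤ) ≡ D + (0ℤ + v)
    e = solve-∀
  -- A step A⁻ needs v - u ≤ d and a step B⁺ needs v - u > - d; one of the two
  -- holds.
  descend k +[1+ a ] +[1+ b ] r h with 0ℤ ≤? D - (+[1+ b ] - +[1+ a ])
  ... | yes p = descend-A⁻ k a +[1+ b ] r p h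
  ... | no ¬p = descend-B⁺ k +[1+ a ] b r
    (0≤-resp (e D +[1+ a ] +[1+ b ])
      (0≤-+ (i≤j⇒0≤j-i (i<j⇒suc[i]≤j (≰⇒> ¬p))) (+≥0 {d ℕ.+ d}))) h
    where
    e : ∀ D u v → D + (v - u) - 1ℤ ≡ (0ℤ - (1ℤ + (D - (v - u)))) + (D + D)
    e = solve-∀

  pinwheel-connected : Connected underlying
  pinwheel-connected x y = toCenter x ◅◅ reverse (λ {x} {y} → edge-sym {x} {y}) (toCenter y)
    where
    edge-sym : ∀ {x y} → Digraph.Edge underlying x y → Digraph.Edge underlying y x
    edge-sym {x} {y} (i , a) = oppositeDirection i ,
      arc-reverse (pinwheelPotential n d) {x} {y} {i} a
    toCenter : ∀ x → Walk x (center₀ 0F)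
    toCenter ((k , u , v) , [ r ]) = descend k u v r (<-wellFounded _)

------------------------------------------------------------------------
-- Moves and directions

private
  ◃-* : ∀ s n → s ◃ n ≡ (s ◃ 1) * + n
  ◃-* Sign.+ n = trans (+◃n≡+n n) (sym (*-identityˡ (+ n)))
  ◃-* Sign.- n = trans (-◃n≡-n n) (sym (-1*i≡-i (+ n)))

  diagonal : ∀ s t p q → mat (s ◃ 1) 0ℤ 0ℤ (t ◃ 1) *ᵛ (+ p , + q) ≡ (s ◃ p , t ◃ q)
  diagonal s t p q = cong₂ _,_
    (trans (+-identityʳ _) (sym (◃-* s p)))
    (trans (+-identityˡ _) (sym (◃-* t q)))

  antidiagonal : ∀ s t p q → mat 0ℤ (s ◃ 1) (t ◃ 1) 0ℤ *ᵛ (+ p , + q) ≡ (s ◃ q , t ◃ p)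
  antidiagonal s t p q = cong₂ _,_
    (trans (+-identityˡ _) (sym (◃-* s q)))
    (trans (+-identityʳ _) (sym (◃-* t p)))

module _ (L : Leaper) where
  open Leaper L

  move⇔ : ∀ {a b} → Move a b ⇔ (∃[ i ] b ≡ a +ᵛ directionMatrix i *ᵛ vector)
  move⇔ {a} {b} = mk⇔ to from
    where
    shift : ∀ {x y} → x ≡ y → b ≡ a +ᵛ x → b ≡ a +ᵛ y
    shift refl eq = eq
    diag : ∀ s t → b ≡ a +ᵛ (s ◃ p , t ◃ q) → b ≡ a +ᵛ mat (s ◃ 1) 0ℤ 0ℤ (t ◃ 1) *ᵛ vector
    diag s t = shift (sym (diagonal s t p q))
    anti : ∀ s t → b ≡ a +ᵛ (s ◃ q , t ◃ p) → b ≡ a +ᵛ mat 0ℤ (s ◃ 1) (t ◃ 1) 0ℤ *ᵛ vector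
    anti s t = shift (sym (antidiagonal s t p q))
    diag⁻ : ∀ s t → b ≡ a +ᵛ mat (s ◃ 1) 0ℤ 0ℤ (t ◃ 1) *ᵛ vector → Move a b
    diag⁻ s t eq = s , t , inj₁ (shift (diagonal s t p q) eq)
    anti⁻ : ∀ s t → b ≡ a +ᵛ mat 0ℤ (s ◃ 1) (t ◃ 1) 0ℤ *ᵛ vector → Move a b
    anti⁻ s t eq = s , t , inj₂ (shift (antidiagonal s t p q) eq)

    to : Move a b → ∃[ i ] b ≡ a +ᵛ directionMatrix i *ᵛ vector
    to (Sign.+ , Sign.+ , inj₁ eq) = d₂ , diag Sign.+ Sign.+ eq
    to (Sign.- , Sign.+ , inj₁ eq) = d₃ , diag Sign.- Sign.+ eq
    to (Sign.- , Sign.- , inj₁ eq) = d₆ , diag Sign.- Sign.- eq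
    to (Sign.+ , Sign.- , inj₁ eq) = d₇ , diag Sign.+ Sign.- eq
    to (Sign.+ , Sign.+ , inj₂ eq) = d₁ , anti Sign.+ Sign.+ eq
    to (Sign.- , Sign.+ , inj₂ eq) = d₄ , anti Sign.- Sign.+ eq
    to (Sign.- , Sign.- , inj₂ eq) = d₅ , anti Sign.- Sign.- eq
    to (Sign.+ , Sign.- , inj₂ eq) = d₈ , anti Sign.+ Sign.- eq

    from : ∃[ i ] b ≡ a +ᵛ directionMatrix i *ᵛ vector → Move a b
    from (d₁ , eq) = anti⁻ Sign.+ Sign.+ eq
    from (d₂ , eq) = diag⁻ Sign.+ Sign.+ eq
    from (d₃ , eq) = diag⁻ Sign.- Sign.+ eq
    from (d₄ , eq) = anti⁻ Sign.- Sign.+ eq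
    from (d₅ , eq) = anti⁻ Sign.- Sign.- eq
    from (d₆ , eq) = diag⁻ Sign.- Sign.- eq
    from (d₇ , eq) = diag⁻ Sign.+ Sign.- eq
    from (d₈ , eq) = anti⁻ Sign.+ Sign.- eq

------------------------------------------------------------------------
-- Positions are determined by squares

-- If k is not zero, then the absolute value of kcq is at least cq, which
-- exceeds cp and hence the absolute value of ap.
small-multiple : ∀ {p q} c → .{{_ : ℕ.NonZero c}} → .{{_ : ℕ.NonZero p}} → p ℕ.< q →
  ∀ a k → ∣ a ∣ ℕ.≤ c → a * + p + k * + c * + q ≡ 0ℤ → a ≡ 0ℤ × k ≡ 0ℤ
small-multiple {p} {q} c p<q a k a≤c eq = a≡0 , k≡0
  where
  open ℕ.≤-Reasoning
  sizes : ∣ a ∣ ℕ.* p ≡ ∣ k ∣ ℕ.* (c ℕ.* q)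
  sizes = begin-equality
    ∣ a ∣ ℕ.* p             ≡⟨ abs-* a (+ p) ⟨
    ∣ a * + p ∣             ≡⟨ cong ∣_∣ (e (a * + p) (k * + c * + q)) ⟩
    ∣ a * + p + k * + c * + q - k * + c * + q ∣  ≡⟨ cong (λ x → ∣ x - k * + c * + q ∣) eq ⟩
    ∣ 0ℤ - k * + c * + q ∣    ≡⟨ cong ∣_∣ (+-identityˡ (- (k * + c * + q))) ⟩
    ∣ - (k * + c * + q) ∣   ≡⟨ ∣-i∣≡∣i∣ (k * + c * + q) ⟩
    ∣ k * + c * + q ∣       ≡⟨ abs-* (k * + c) (+ q) ⟩
    ∣ k * + c ∣ ℕ.* q       ≡⟨ cong (ℕ._* q) (abs-* k (+ c)) ⟩
    ∣ k ∣ ℕ.* c ℕ.* q       ≡⟨ ℕ.*-assoc ∣ k ∣ c q ⟩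
    ∣ k ∣ ℕ.* (c ℕ.* q)     ∎
    where
    e : ∀ x y → x ≡ x + y - y
    e = solve-∀
  ∣k∣≡0 : ∣ k ∣ ≡ 0
  ∣k∣≡0 = go ∣ k ∣ sizes
    where
    go : ∀ m → ∣ a ∣ ℕ.* p ≡ m ℕ.* (c ℕ.* q) → m ≡ 0
    go zero    _  = refl
    go (suc m) eq = contradiction (begin-strict
      ∣ a ∣ ℕ.* p            ≤⟨ ℕ.*-monoˡ-≤ p a≤c ⟩
      c ℕ.* p                <⟨ ℕ.*-monoʳ-< c p<q ⟩
      c ℕ.* q                ≤⟨ ℕ.m≤m+n (c ℕ.* q) _ ⟩
      suc m ℕ.* (c ℕ.* q)    ≡⟨ eq ⟨
      ∣ a ∣ ℕ.* p            ∎) (ℕ.<-irrefl refl)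
  k≡0 : k ≡ 0ℤ
  k≡0 = ∣i∣≡0⇒i≡0 ∣k∣≡0
  a≡0 : a ≡ 0ℤ
  a≡0 = ∣i∣≡0⇒i≡0 (ℕ.m*n≡0⇒m≡0 ∣ a ∣ p (trans sizes (cong (ℕ._* (c ℕ.* q)) ∣k∣≡0)))

row-rigid : ∀ {p q} c → .{{_ : ℕ.NonZero c}} → .{{_ : ℕ.NonZero p}} → p ℕ.< q →
  ∀ {a b a′ b′} → ∣ a′ - a ∣ ℕ.≤ c → + c ∣ᶻ b′ - b →
  a′ * + p + b′ * + q ≡ a * + p + b * + q → a′ ≡ a × b′ ≡ b
row-rigid {p} {q} c p<q {a} {b} {a′} {b′} small (dividesᶻ k k-eq) eq =
  i-j≡0⇒i≡j a′ a (proj₁ both) ,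
  i-j≡0⇒i≡j b′ b (trans k-eq (cong (_* + c) (proj₂ both)))
  where
  open ≡-Reasoning
  e₁ : ∀ a b a′ b′ p q → (a′ - a) * p + (b′ - b) * q ≡ (a′ * p + b′ * q) - (a * p + b * q)
  e₁ = solve-∀
  e₂ : ∀ x → x - x ≡ 0ℤ
  e₂ = solve-∀
  both : a′ - a ≡ 0ℤ × k ≡ 0ℤ
  both = small-multiple c p<q (a′ - a) k small (begin
    (a′ - a) * + p + k * + c * + q                    ≡⟨ cong (λ x → (a′ - a) * + p + x * + q) k-eq ⟨
    (a′ - a) * + p + (b′ - b) * + q                   ≡⟨ e₁ a b a′ b′ (+ p) (+ q) ⟩
    (a′ * + p + b′ * + q) - (a * + p + b * + q)       ≡⟨ cong (_- (a * + p + b * + q)) eq ⟩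
    (a * + p + b * + q) - (a * + p + b * + q)         ≡⟨ e₂ (a * + p + b * + q) ⟩
    0ℤ                                                ∎)

-- The possible entries of the first column of a position matrix.
IsBit : ℤ → Set
IsBit x = x ≡ 0ℤ ⊎ x ≡ -1ℤ

-- The properties of position matrices that rigidity needs.  The first column
-- determines the second one modulo 2.
record IsPosition (X : Matrix) : Set where
  open Matrix X
  field
    bit₁    : IsBit m₁₁
    bit₂    : IsBit m₂₁
    parity₁ : + 2 ∣ᶻ m₁₂ - m₂₁
    parity₂ : + 2 ∣ᶻ m₂₂ - m₁₁ - 1ℤ

-- One entry of the first column is 0, and the other one is 0, 1 or -1 and has
-- an even entry to its right.  This covers the moves of both leapers and the
-- zero matrix.
data IsStep : Matrix → Set where
  upper : ∀ {a b d} → ∣ a ∣ ℕ.≤ 1 → + 2 ∣ᶻ b → IsStep (mat a b 0ℤ d)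
  lower : ∀ {b c d} → ∣ c ∣ ℕ.≤ 1 → + 2 ∣ᶻ d → IsStep (mat 0ℤ b c d)

isPosition : ∀ x → IsPosition (positionMatrix x)
isPosition (k , w) = go k
  where
  ∣-resp : ∀ {x y} → y ≡ x → + 2 ∣ᶻ x → + 2 ∣ᶻ y
  ∣-resp refl p = p
  turned : ∀ {X} → IsPosition X → IsPosition (turn X)
  turned {mat a b c d} h = record
    { bit₁    = flip bit₂
    ; bit₂    = bit₁
    ; parity₁ = ∣-resp (e₁ a d) (∣m∣n⇒∣m-n (∣m⇒∣-m parity₂) (dividesᶻ (a + 1ℤ) refl))
    ; parity₂ = ∣-resp (e₂ b c) (∣m∣n⇒∣m+n parity₁ (dividesᶻ c refl))
    }
    where
    open IsPosition h
    flip : ∀ {c} → IsBit c → IsBit (- c - 1ℤ)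
    flip (inj₁ refl) = inj₂ refl
    flip (inj₂ refl) = inj₁ refl
    e₁ : ∀ a d → - d - 1ℤ - a ≡ - (d - a - 1ℤ) - (a + 1ℤ) * + 2
    e₁ = solve-∀
    e₂ : ∀ b c → b - (- c - 1ℤ) - 1ℤ ≡ b - c + c * + 2
    e₂ = solve-∀
  next-isPosition : ∀ k → IsPosition (positionMatrix (k , w)) → IsPosition (positionMatrix (next k , w))
  next-isPosition k h = subst IsPosition (sym (positionMatrix-next k w)) (turned h)
  first : IsPosition (positionMatrix (0F , w))
  first = record
    { bit₁    = inj₁ refl
    ; bit₂    = inj₁ refl
    ; parity₁ = dividesᶻ (proj₁ w) (e₁ (proj₁ w))
    ; parity₂ = dividesᶻ (proj₂ w - 1ℤ) (e₂ (proj₂ w))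
    }
    where
    e₁ : ∀ u → + 2 * u - 0ℤ ≡ u * + 2
    e₁ = solve-∀
    e₂ : ∀ v → + 2 * v - 1ℤ - 0ℤ - 1ℤ ≡ (v - 1ℤ) * + 2
    e₂ = solve-∀
  go : ∀ k → IsPosition (positionMatrix (k , w))
  go 0F = first
  go 1F = next-isPosition 0F first
  go 2F = next-isPosition 1F (next-isPosition 0F first)
  go 3F = next-isPosition 2F (next-isPosition 1F (next-isPosition 0F first))

zero-isStep : IsStep 0ᴹ
zero-isStep = upper z≤n (dividesᶻ 0ℤ refl)

direction-isStep : ∀ i → IsStep (directionMatrix i)
direction-isStep d₁ = lower (s≤s z≤n) (dividesᶻ 0ℤ refl)
direction-isStep d₂ = upper (s≤s z≤n) (dividesᶻ 0ℤ refl)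
direction-isStep d₃ = upper (s≤s z≤n) (dividesᶻ 0ℤ refl)
direction-isStep d₄ = lower (s≤s z≤n) (dividesᶻ 0ℤ refl)
direction-isStep d₅ = lower (s≤s z≤n) (dividesᶻ 0ℤ refl)
direction-isStep d₆ = upper (s≤s z≤n) (dividesᶻ 0ℤ refl)
direction-isStep d₇ = upper (s≤s z≤n) (dividesᶻ 0ℤ refl)
direction-isStep d₈ = lower (s≤s z≤n) (dividesᶻ 0ℤ refl)

direction*pinwheel-isStep : ∀ n i → IsStep (directionMatrix i *ᴹ pinwheelMatrix n)
direction*pinwheel-isStep n = λ
  { d₁ → upper (s≤s z≤n) (dividesᶻ N (positive N))
  ; d₂ → lower (s≤s z≤n) (dividesᶻ N (positive N))
  ; d₃ → lower (s≤s z≤n) (dividesᶻ N (positive N))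
  ; d₄ → upper (s≤s z≤n) (dividesᶻ (- N) (negative N))
  ; d₅ → upper (s≤s z≤n) (dividesᶻ (- N) (negative N))
  ; d₆ → lower (s≤s z≤n) (dividesᶻ (- N) (negative N))
  ; d₇ → lower (s≤s z≤n) (dividesᶻ (- N) (negative N))
  ; d₈ → upper (s≤s z≤n) (dividesᶻ N (positive N))
  }
  where
  N = + n
  positive : ∀ N → 0ℤ * 1ℤ + 1ℤ * (+ 2 * N) ≡ N * + 2
  positive = solve-∀
  negative : ∀ N → 0ℤ * 1ℤ + -1ℤ * (+ 2 * N) ≡ - N * + 2
  negative = solve-∀

private
  bits-close : ∀ {x y} → IsBit x → IsBit y → ∣ y - x ∣ ℕ.≤ 1
  bits-close (inj₁ refl) (inj₁ refl) = z≤n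
  bits-close (inj₁ refl) (inj₂ refl) = s≤s z≤n
  bits-close (inj₂ refl) (inj₁ refl) = s≤s z≤n
  bits-close (inj₂ refl) (inj₂ refl) = z≤n

  bits-close-shift : ∀ {x y} → IsBit x → IsBit y → ∀ {z} → ∣ z ∣ ℕ.≤ 1 → ∣ y - (x + z) ∣ ℕ.≤ 2
  bits-close-shift {x} {y} hx hy {z} hz = begin
    ∣ y - (x + z) ∣           ≡⟨ cong ∣_∣ (e x y z) ⟩
    ∣ (y - x) + - z ∣         ≤⟨ ∣i+j∣≤∣i∣+∣j∣ (y - x) (- z) ⟩
    ∣ y - x ∣ ℕ.+ ∣ - z ∣     ≡⟨ cong (∣ y - x ∣ ℕ.+_) (∣-i∣≡∣i∣ z) ⟩
    ∣ y - x ∣ ℕ.+ ∣ z ∣       ≤⟨ ℕ.+-mono-≤ (bits-close hx hy) hz ⟩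
    2                         ∎
    where
    open ℕ.≤-Reasoning
    e : ∀ x y z → y - (x + z) ≡ (y - x) + - z
    e = solve-∀

-- Consider the first column of Y - (X + N).  In the row where N has a zero
-- there, the entry is 0, 1 or -1, so row-rigid with c = 1 shows that this row
-- vanishes.  The other entry of the first column has absolute value at most 2
-- and, by the parity conditions, an even entry to its right, so row-rigid
-- applies with c = 2.
rigid : ∀ {p q} → .{{_ : ℕ.NonZero p}} → p ℕ.< q → ∀ {X Y N} →
  IsPosition X → IsPosition Y → IsStep N →
  Y *ᵛ (+ p , + q) ≡ (X +ᴹ N) *ᵛ (+ p , + q) → Y ≡ X +ᴹ N
rigid {p} {q} p<q {mat a b c d} {mat a′ b′ c′ d′} hX hY (upper {n₁} {n₂} {n₃} n₁≤1 n₂-even) eq =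
  mat-cong (proj₁ row₁) (proj₂ row₁) (proj₁ row₂) (proj₂ row₂)
  where
  module X = IsPosition hX
  module Y = IsPosition hY
  row₂ : c′ ≡ c + 0ℤ × d′ ≡ d + n₃
  row₂ = row-rigid 1 p<q
    (subst (λ x → ∣ c′ - x ∣ ℕ.≤ 1) (sym (+-identityʳ c)) (bits-close X.bit₂ Y.bit₂))
    (dividesᶻ (d′ - (d + n₃)) (sym (*-identityʳ _)))
    (cong proj₂ eq)
  e : ∀ b c n b′ → (b′ - (c + 0ℤ)) - (b - c) - n ≡ b′ - (b + n)
  e = solve-∀
  row₁ : a′ ≡ a + n₁ × b′ ≡ b + n₂
  row₁ = row-rigid 2 p<q
    (bits-close-shift X.bit₁ Y.bit₁ n₁≤1)
    (subst (+ 2 ∣ᶻ_) (e b c n₂ b′) (∣m∣n⇒∣m-n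
      (∣m∣n⇒∣m-n (subst (λ x → + 2 ∣ᶻ b′ - x) (proj₁ row₂) Y.parity₁) X.parity₁) n₂-even))
    (cong proj₁ eq)
rigid {p} {q} p<q {mat a b c d} {mat a′ b′ c′ d′} hX hY (lower {n₁} {n₂} {n₃} n₂≤1 n₃-even) eq =
  mat-cong (proj₁ row₁) (proj₂ row₁) (proj₁ row₂) (proj₂ row₂)
  where
  module X = IsPosition hX
  module Y = IsPosition hY
  row₁ : a′ ≡ a + 0ℤ × b′ ≡ b + n₁
  row₁ = row-rigid 1 p<q
    (subst (λ x → ∣ a′ - x ∣ ℕ.≤ 1) (sym (+-identityʳ a)) (bits-close X.bit₁ Y.bit₁))
    (dividesᶻ (b′ - (b + n₁)) (sym (*-identityʳ _)))
    (cong proj₁ eq)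
  e : ∀ a d n d′ → (d′ - (a + 0ℤ) - 1ℤ) - (d - a - 1ℤ) - n ≡ d′ - (d + n)
  e = solve-∀
  row₂ : c′ ≡ c + n₂ × d′ ≡ d + n₃
  row₂ = row-rigid 2 p<q
    (bits-close-shift X.bit₂ Y.bit₂ n₂≤1)
    (subst (+ 2 ∣ᶻ_) (e a d n₃ d′) (∣m∣n⇒∣m-n
      (∣m∣n⇒∣m-n (subst (λ x → + 2 ∣ᶻ d′ - x - 1ℤ) (proj₁ row₁) Y.parity₂) X.parity₂) n₃-even))
    (cong proj₂ eq)

------------------------------------------------------------------------
-- The squares of the board as vertices

private
  0≤-*⁺ : ∀ m {e} → 0ℤ ≤ e → 0ℤ ≤ + m * e
  0≤-*⁺ m {e} p = subst (_≤ + m * e) (*-zeroʳ (+ m)) (*-monoˡ-≤-nonNeg (+ m) p)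

  0≤-*⁻ : ∀ m .{{_ : ℕ.NonZero m}} {e} → 0ℤ ≤ + m * e → 0ℤ ≤ e
  0≤-*⁻ (suc m) {e} p =
    *-cancelˡ-≤-pos 0ℤ e +[1+ m ] (subst (_≤ +[1+ m ] * e) (sym (*-zeroʳ +[1+ m ])) p)

rotateClockwise-injective : ∀ {x y} → rotateClockwise x ≡ rotateClockwise y → x ≡ y
rotateClockwise-injective eq =
  cong₂ _,_ (neg-injective (cong proj₂ eq)) (cong proj₁ eq)

-- The clockwise rotation by k quarter turns, which takes the quarter k back to
-- the first one.
unrotate : Fin 4 → Point → Point
unrotate 0F x = x
unrotate 1F x = rotateClockwise x
unrotate 2F x = rotateClockwise (rotateClockwise x)
unrotate 3F x = rotateClockwise (rotateClockwise (rotateClockwise x))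

unrotate-injective : ∀ k {x y} → unrotate k x ≡ unrotate k y → x ≡ y
unrotate-injective 0F eq = eq
unrotate-injective 1F eq = rotateClockwise-injective eq
unrotate-injective 2F eq = rotateClockwise-injective (rotateClockwise-injective eq)
unrotate-injective 3F eq =
  rotateClockwise-injective (rotateClockwise-injective (rotateClockwise-injective eq))

module _ (L : Leaper) where
  open Leaper L
  private
    P = + p
    Q = + q
    half : ℤ
    half = + ((p ℕ.+ q) ℕ./ 2)
    offset : ℤ
    offset = + ((p ℕ.+ q) ℕ.% 2)

    P+Q : P + Q ≡ offset + half * + 2
    P+Q = trans (cong +_ (m≡m%n+[m/n]*n (p ℕ.+ q) 2))
                (cong (λ x → offset + x) (pos-* ((p ℕ.+ q) ℕ./ 2) 2))

  -- The square whose position is X.  The zero matrix belongs to the square with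
  -- center ((p + q) / 2 , (p + q) / 2).
  squareAt : Matrix → Square
  squareAt X = (half , half) +ᵛ X *ᵛ vector

  -- Its center, in doubled coordinates.
  pointAt : Matrix → Point
  pointAt (mat a b c d) =
    ((+ 2 * a + 1ℤ) * P + (+ 2 * b + 1ℤ) * Q , (+ 2 * c + 1ℤ) * P + (+ 2 * d + 1ℤ) * Q)

  center-squareAt : ∀ X → center L (squareAt X) ≡ pointAt X
  center-squareAt (mat a b c d) = cong₂ _,_ (entry a b) (entry c d)
    where
    e₁ : ∀ h o a b P Q → + 2 * (h + (a * P + b * Q)) + o ≡ + 2 * (a * P + b * Q) + (o + h * + 2)
    e₁ = solve-∀
    e₂ : ∀ a b P Q → + 2 * (a * P + b * Q) + (P + Q) ≡ (+ 2 * a + 1ℤ) * P + (+ 2 * b + 1ℤ) * Q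
    e₂ = solve-∀
    entry : ∀ a b → + 2 * (half + (a * P + b * Q)) + offset ≡ (+ 2 * a + 1ℤ) * P + (+ 2 * b + 1ℤ) * Q
    entry a b = trans (e₁ half offset a b P Q)
      (trans (cong (λ x → + 2 * (a * P + b * Q) + x) (sym P+Q)) (e₂ a b P Q))

  center-injective : ∀ {a b} → center L a ≡ center L b → a ≡ b
  center-injective eq = cong₂ _,_ (entry (cong proj₁ eq)) (entry (cong proj₂ eq))
    where
    entry : ∀ {x y} → + 2 * x + offset ≡ + 2 * y + offset → x ≡ y
    entry {x} {y} eq = *-cancelˡ-≡ (+ 2) x y
      (trans (e (+ 2 * x) offset) (trans (cong (_- offset) eq) (sym (e (+ 2 * y) offset))))
      where
      e : ∀ x o → x ≡ x + o - o
      e = solve-∀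

  pointAt-turn : ∀ X → rotateClockwise (pointAt (turn X)) ≡ pointAt X
  pointAt-turn (mat a b c d) = cong (_ ,_) (entry c d P Q)
    where
    entry : ∀ c d P Q →
      - ((+ 2 * (- c - 1ℤ) + 1ℤ) * P + (+ 2 * (- d - 1ℤ) + 1ℤ) * Q) ≡
      (+ 2 * c + 1ℤ) * P + (+ 2 * d + 1ℤ) * Q
    entry = solve-∀

  pointAt-next : ∀ k w →
    rotateClockwise (pointAt (positionMatrix (next k , w))) ≡ pointAt (positionMatrix (k , w))
  pointAt-next k w = trans (cong (rotateClockwise ∘ pointAt) (positionMatrix-next k w))
                           (pointAt-turn (positionMatrix (k , w)))

  unrotate-pointAt : ∀ k w →
    unrotate k (pointAt (positionMatrix (k , w))) ≡ pointAt (positionMatrix (0F , w))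
  unrotate-pointAt 0F w = refl
  unrotate-pointAt 1F w = pointAt-next 0F w
  unrotate-pointAt 2F w = trans (cong rotateClockwise (pointAt-next 1F w)) (pointAt-next 0F w)
  unrotate-pointAt 3F w =
    trans (cong (rotateClockwise ∘ rotateClockwise) (pointAt-next 2F w))
      (trans (cong rotateClockwise (pointAt-next 1F w)) (pointAt-next 0F w))

  module _ (n d : ℕ) where
    private
      N = + n
      D = + d
      first : Vec² → Point
      first w = pointAt (positionMatrix (0F , w))

    -- The slack in each of the four inequalities that define WI, at the point
    -- with coordinates u and v, is 4q times a slack of the region.
    bound₁ : ∀ u v → let (x , y) = first (u , v) in
      x + y - + 2 * (P - + 2 * D * Q) ≡ Q * (+ 4 * (D + (u + v)))
    bound₁ u v = entry P Q D u v
      where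
      entry : ∀ P Q D u v →
        ((+ 2 * 0ℤ + 1ℤ) * P + (+ 2 * (+ 2 * u) + 1ℤ) * Q) +
        ((+ 2 * 0ℤ + 1ℤ) * P + (+ 2 * (+ 2 * v - 1ℤ) + 1ℤ) * Q) -
        + 2 * (P - + 2 * D * Q) ≡ Q * (+ 4 * (D + (u + v)))
      entry = solve-∀

    bound₂ : ∀ u v → let (x , y) = first (u , v) in
      + 2 * (P + + 2 * (N + D) * Q) - (x + y) ≡ Q * (+ 4 * (N + D - (u + v)))
    bound₂ u v = entry P Q N D u v
      where
      entry : ∀ P Q N D u v →
        + 2 * (P + + 2 * (N + D) * Q) -
        (((+ 2 * 0ℤ + 1ℤ) * P + (+ 2 * (+ 2 * u) + 1ℤ) * Q) +
         ((+ 2 * 0ℤ + 1ℤ) * P + (+ 2 * (+ 2 * v - 1ℤ) + 1ℤ) * Q))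
        ≡ Q * (+ 4 * (N + D - (u + v)))
      entry = solve-∀

    bound₃ : ∀ u v → let (x , y) = first (u , v) in
      y - x - + 2 * (- (+ 2 * N + + 2 * D - 1ℤ) * Q) ≡ Q * (+ 4 * (N + D - 1ℤ + (v - u)))
    bound₃ u v = entry P Q N D u v
      where
      entry : ∀ P Q N D u v →
        ((+ 2 * 0ℤ + 1ℤ) * P + (+ 2 * (+ 2 * v - 1ℤ) + 1ℤ) * Q) -
        ((+ 2 * 0ℤ + 1ℤ) * P + (+ 2 * (+ 2 * u) + 1ℤ) * Q) -
        + 2 * (- (+ 2 * N + + 2 * D - 1ℤ) * Q) ≡ Q * (+ 4 * (N + D - 1ℤ + (v - u)))
      entry = solve-∀

    bound₄ : ∀ u v → let (x , y) = first (u , v) in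
      + 2 * ((+ 2 * N + + 2 * D - 1ℤ) * Q) - (y - x) ≡ Q * (+ 4 * (N + D - (v - u)))
    bound₄ u v = entry P Q N D u v
      where
      entry : ∀ P Q N D u v →
        + 2 * ((+ 2 * N + + 2 * D - 1ℤ) * Q) -
        (((+ 2 * 0ℤ + 1ℤ) * P + (+ 2 * (+ 2 * v - 1ℤ) + 1ℤ) * Q) -
         ((+ 2 * 0ℤ + 1ℤ) * P + (+ 2 * (+ 2 * u) + 1ℤ) * Q))
        ≡ Q * (+ 4 * (N + D - (v - u)))
      entry = solve-∀

    WI-intro : ∀ {w} → Region n d w → WI n d L (first w)
    WI-intro {u , v} (region s⁻ s⁺ t⁻ t⁺) =
        dividesᶻ u (e₁ P Q u)
      , dividesᶻ v (e₂ P Q v)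
      , bounded (bound₁ u v) s⁻
      , bounded (bound₂ u v) s⁺
      , bounded (bound₃ u v) t⁻
      , bounded (bound₄ u v) t⁺
      where
      e₁ : ∀ P Q u →
        (+ 2 * 0ℤ + 1ℤ) * P + (+ 2 * (+ 2 * u) + 1ℤ) * Q - (P + Q) ≡ u * (+ 2 * (+ 2 * Q))
      e₁ = solve-∀
      e₂ : ∀ P Q v →
        (+ 2 * 0ℤ + 1ℤ) * P + (+ 2 * (+ 2 * v - 1ℤ) + 1ℤ) * Q - (P - Q) ≡ v * (+ 2 * (+ 2 * Q))
      e₂ = solve-∀
      bounded : ∀ {x y e} → y - x ≡ Q * (+ 4 * e) → 0ℤ ≤ e → x ≤ y
      bounded eq p = 0≤i-j⇒j≤i (0≤-resp eq (0≤-*⁺ q (0≤-*⁺ 4 p)))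

    WI-elim : .{{_ : ℕ.NonZero q}} → ∀ {z} → WI n d L z → ∃[ w ] (Region n d w × z ≡ first w)
    WI-elim {x , y} m@(dividesᶻ u x≡ , dividesᶻ v y≡ , _) =
      (u , v) , conditions (subst (WI n d L) z≡ m) , z≡
      where
      e₀ : ∀ x a → x ≡ x - a + a
      e₀ = solve-∀
      e₁ : ∀ P Q u →
        u * (+ 2 * (+ 2 * Q)) + (P + Q) ≡ (+ 2 * 0ℤ + 1ℤ) * P + (+ 2 * (+ 2 * u) + 1ℤ) * Q
      e₁ = solve-∀
      e₂ : ∀ P Q v →
        v * (+ 2 * (+ 2 * Q)) + (P - Q) ≡ (+ 2 * 0ℤ + 1ℤ) * P + (+ 2 * (+ 2 * v - 1ℤ) + 1ℤ) * Q
      e₂ = solve-∀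
      z≡ : (x , y) ≡ first (u , v)
      z≡ = cong₂ _,_
        (trans (e₀ x (P + Q)) (trans (cong (_+ (P + Q)) x≡) (e₁ P Q u)))
        (trans (e₀ y (P - Q)) (trans (cong (_+ (P - Q)) y≡) (e₂ P Q v)))
      unbounded : ∀ {x y e} → y - x ≡ Q * (+ 4 * e) → x ≤ y → 0ℤ ≤ e
      unbounded eq p = 0≤-*⁻ 4 (0≤-*⁻ q (0≤-resp (sym eq) (i≤j⇒0≤j-i p)))
      conditions : WI n d L (first (u , v)) → Region n d (u , v)
      conditions (_ , _ , s⁻ , s⁺ , t⁻ , t⁺) = region
        (unbounded (bound₁ u v) s⁻)
        (unbounded (bound₂ u v) s⁺)
        (unbounded (bound₃ u v) t⁻)
        (unbounded (bound₄ u v) t⁺)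

    private
      B = expandedPinwheelBoard n d L

    ∈-board : ∀ a k → WI n d L (unrotate k (center L a)) → B a
    ∈-board a 0F m = inj₁ m
    ∈-board a 1F m = inj₂ (inj₁ m)
    ∈-board a 2F m = inj₂ (inj₂ (inj₁ m))
    ∈-board a 3F m = inj₂ (inj₂ (inj₂ m))

    board⇒quarter : ∀ a → B a → ∃[ k ] WI n d L (unrotate k (center L a))
    board⇒quarter a (inj₁ m)               = 0F , m
    board⇒quarter a (inj₂ (inj₁ m))        = 1F , m
    board⇒quarter a (inj₂ (inj₂ (inj₁ m))) = 2F , m
    board⇒quarter a (inj₂ (inj₂ (inj₂ m))) = 3F , m

    WI? : ∀ z → Dec (WI n d L z)
    WI? (x , y) =
      (_ ∣ᶻ? _) ×-dec (_ ∣ᶻ? _) ×-dec (_ ≤? _) ×-dec (_ ≤? _) ×-dec (_ ≤? _) ×-dec (_ ≤? _)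

    board? : ∀ a → Dec (B a)
    board? a = WI? (unrotate 0F z) ⊎-dec WI? (unrotate 1F z)
           ⊎-dec WI? (unrotate 2F z) ⊎-dec WI? (unrotate 3F z)
      where z = center L a

    squareAt-∈ : ∀ k w → Region n d w → B (squareAt (positionMatrix (k , w)))
    squareAt-∈ k w r = ∈-board (squareAt (positionMatrix (k , w))) k (subst (WI n d L) (sym (trans
      (cong (unrotate k) (center-squareAt (positionMatrix (k , w)))) (unrotate-pointAt k w)))
      (WI-intro r))

    locate : .{{_ : ℕ.NonZero q}} → ∀ a → B a →
      ∃[ x ] (Region n d (proj₂ x) × a ≡ squareAt (positionMatrix x))
    locate a m = found (board⇒quarter a m)
      where
      found : ∃[ k ] WI n d L (unrotate k (center L a)) →
        ∃[ x ] (Region n d (proj₂ x) × a ≡ squareAt (positionMatrix x))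
      found (k , mₖ) = let (w , r , eq) = WI-elim mₖ in
        (k , w) , r , center-injective (unrotate-injective k (trans eq (sym (trans
          (cong (unrotate k) (center-squareAt (positionMatrix (k , w)))) (unrotate-pointAt k w)))))

module BoardVertices (n d : ℕ) (L : Leaper)
  (p≢0 : Leaper.p L ≢ 0) (p<q : Leaper.p L ℕ.< Leaper.q L) where
  open Leaper L
  private
    B = expandedPinwheelBoard n d L
    open LabelledGraph (pinwheelGraph n d) using (Vertex)
    instance
      p-nonZero : ℕ.NonZero p
      p-nonZero = ℕ.≢-nonZero p≢0
      q-nonZero : ℕ.NonZero q
      q-nonZero = ℕ.>-nonZero (ℕ.≤-<-trans z≤n p<q)

  -- Rigidity in terms of squares.
  displacement⇔ : ∀ x y {N} → IsStep N →
    squareAt L (positionMatrix y) ≡ squareAt L (positionMatrix x) +ᵛ N *ᵛ vector ⇔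
    positionMatrix y ≡ positionMatrix x +ᴹ N
  displacement⇔ x y {N} N-step = mk⇔
    (λ eq → rigid p<q (isPosition x) (isPosition y) N-step
      (+ᵛ-cancelˡ base (trans eq shifted)))
    (λ eq → trans (cong (λ X → base +ᵛ X *ᵛ vector) eq) (sym shifted))
    where
    base : Vec²
    base = (+ ((p ℕ.+ q) ℕ./ 2) , + ((p ℕ.+ q) ℕ./ 2))
    X = positionMatrix x
    shifted : squareAt L X +ᵛ N *ᵛ vector ≡ base +ᵛ (X +ᴹ N) *ᵛ vector
    shifted = trans (+ᵛ-assoc base (X *ᵛ vector) (N *ᵛ vector))
                    (cong (base +ᵛ_) (sym (*ᵛ-distribʳ-+ᴹ X N vector)))

  squareAt-injective : ∀ {x y} →
    squareAt L (positionMatrix x) ≡ squareAt L (positionMatrix y) → x ≡ y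
  squareAt-injective {x} {y} eq = sym (positionMatrix-injective
    (trans (Equivalence.to (displacement⇔ x y zero-isStep) eq′) (+ᴹ-identityʳ (positionMatrix x))))
    where
    e : ∀ x → x ≡ x + 0ℤ
    e x = sym (+-identityʳ x)
    eq′ : squareAt L (positionMatrix y) ≡ squareAt L (positionMatrix x) +ᵛ 0ᴹ *ᵛ vector
    eq′ = trans (sym eq) (cong₂ _,_ (e _) (e _))

  -- Membership in a board is irrelevant, but decidable, so coordinates can be
  -- recomputed from it.  Of the vertex only squareAt-vertexOf is used, hence it
  -- need not be unfolded.
  abstract
    vertexOf : SquareOf B → Vertex
    vertexOf (a , [ m ]) =
      let (x , r , _) = locate L n d a (recompute (board? L n d a) m) in x , [ r ]

    squareAt-vertexOf : ∀ s → value s ≡ squareAt L (positionMatrix (value (vertexOf s)))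
    squareAt-vertexOf (a , [ m ]) =
      let (_ , _ , eq) = locate L n d a (recompute (board? L n d a) m) in eq

  squareOf : Vertex → SquareOf B
  squareOf ((k , w) , [ r ]) = squareAt L (positionMatrix (k , w)) , [ squareAt-∈ L n d k w r ]

  squares↔vertices : SquareOf B ↔ Vertex
  squares↔vertices = mk↔ₛ′ vertexOf squareOf
    (λ x → value-injective (squareAt-injective (sym (squareAt-vertexOf (squareOf x)))))
    (λ s → value-injective (sym (squareAt-vertexOf s)))

  square-displacement⇔ : ∀ {a b : SquareOf B} {N} → IsStep N →
    value b ≡ value a +ᵛ N *ᵛ vector ⇔
    positionMatrix (value (vertexOf b)) ≡ positionMatrix (value (vertexOf a)) +ᴹ N
  square-displacement⇔ {a} {b} {N} N-step = subst₂
    (λ x y → y ≡ x +ᵛ N *ᵛ vector ⇔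
      positionMatrix (value (vertexOf b)) ≡ positionMatrix (value (vertexOf a)) +ᴹ N)
    (sym (squareAt-vertexOf a)) (sym (squareAt-vertexOf b))
    (displacement⇔ (value (vertexOf a)) (value (vertexOf b)) N-step)

  extracted≅pinwheelGraph : extracted L B ≅ pinwheelGraph n d
  extracted≅pinwheelGraph = record
    { bijection = squares↔vertices
    ; arcs      = λ {a} {b} {i} → mk⇔
        (λ (_ , eq) → Equivalence.to (square-displacement⇔ {a} {b} (direction-isStep i)) eq)
        (λ eq → let eq′ = Equivalence.from (square-displacement⇔ {a} {b} (direction-isStep i)) eq
                in Equivalence.from (move⇔ L {value a} {value b}) (i , eq′) , eq′)
    }

  leaperGraph-extracted : Isomorphism (leaperGraph L B) (LabelledGraph.underlying (extracted L B))
  leaperGraph-extracted = record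
    { bijection = ↔-refl
    ; edges     = λ {a} {b} → mk⇔
        (λ m → let (i , eq) = Equivalence.to (move⇔ L {value a} {value b}) m in i , m , eq)
        (λ (_ , m , _) → m)
    }

  extractedPotential : Potential (extracted L B)
  extractedPotential = pullbackPotential extracted≅pinwheelGraph (pinwheelPotential n d)

------------------------------------------------------------------------
-- Complements of the pinwheel graph

-- Right multiplication by the matrix with rows (0 , 1) and (-1 , 0), which
-- permutes the direction matrices by π-pinwheel.
turnColumns : Matrix → Matrix
turnColumns (mat a b c d) = mat (- b) a
                                (- d) c

turnColumns⁻¹ : Matrix → Matrix
turnColumns⁻¹ (mat a b c d) = mat b (- a)
                                  d (- c)

-- Left multiplication by the diagonal matrix with entries 1 and -1, which
-- permutes the direction matrices by π-reflect.
reflectRows : Matrix → Matrix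
reflectRows (mat a b c d) = mat a     b
                                (- c) (- d)

pinwheelComplement : ∀ {Φ} → Potential Φ → Potential (relabel π-pinwheel Φ)
pinwheelComplement = relabelPotential π-pinwheel turnColumns turnColumns⁻¹ retract additive
  λ { d₁ → refl ; d₂ → refl ; d₃ → refl ; d₄ → refl
    ; d₅ → refl ; d₆ → refl ; d₇ → refl ; d₈ → refl }
  where
  retract : ∀ X → turnColumns⁻¹ (turnColumns X) ≡ X
  retract (mat a b c d) = mat-cong refl (neg-involutive b) refl (neg-involutive d)
  additive : ∀ X Y → turnColumns (X +ᴹ Y) ≡ turnColumns X +ᴹ turnColumns Y
  additive (mat a b c d) (mat a′ b′ c′ d′) =
    mat-cong (neg-distrib-+ b b′) refl (neg-distrib-+ d d′) refl

reflectComplement : ∀ {Φ} → Potential Φ → Potential (relabel π-reflect Φ)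
reflectComplement = relabelPotential π-reflect reflectRows reflectRows retract additive
  λ { d₁ → refl ; d₂ → refl ; d₃ → refl ; d₄ → refl
    ; d₅ → refl ; d₆ → refl ; d₇ → refl ; d₈ → refl }
  where
  retract : ∀ X → reflectRows (reflectRows X) ≡ X
  retract (mat a b c d) = mat-cong refl refl (neg-involutive c) (neg-involutive d)
  additive : ∀ X Y → reflectRows (X +ᴹ Y) ≡ reflectRows X +ᴹ reflectRows Y
  additive (mat a b c d) (mat a′ b′ c′ d′) =
    mat-cong refl refl (neg-distrib-+ c c′) (neg-distrib-+ d d′)

pinwheelMatrix⁻¹ : ℕ → Matrix
pinwheelMatrix⁻¹ n = mat (- (+ 2 * + n)) 1ℤ
                         1ℤ              0ℤ

*-pinwheelMatrix-retract : ∀ n X → X *ᴹ pinwheelMatrix n *ᴹ pinwheelMatrix⁻¹ n ≡ X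
*-pinwheelMatrix-retract n (mat a b c d) =
  mat-cong (entry₁ a b (+ n)) (entry₂ a b (+ n)) (entry₁ c d (+ n)) (entry₂ c d (+ n))
  where
  entry₁ : ∀ a b N →
    (a * 0ℤ + b * 1ℤ) * - (+ 2 * N) + (a * 1ℤ + b * (+ 2 * N)) * 1ℤ ≡ a
  entry₁ = solve-∀
  entry₂ : ∀ a b N →
    (a * 0ℤ + b * 1ℤ) * 1ℤ + (a * 1ℤ + b * (+ 2 * N)) * 0ℤ ≡ b
  entry₂ = solve-∀

turnColumns-*-pinwheelMatrix : ∀ n a b c d →
  turnColumns (mat a b c d) *ᴹ pinwheelMatrix n ≡
  mat a (+ 2 * + n * a - b)
      c (+ 2 * + n * c - d)
turnColumns-*-pinwheelMatrix n a b c d =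
  mat-cong (entry₁ a b) (entry₂ a b (+ n)) (entry₁ c d) (entry₂ c d (+ n))
  where
  entry₁ : ∀ a b → - b * 0ℤ + a * 1ℤ ≡ a
  entry₁ = solve-∀
  entry₂ : ∀ a b N → - b * 1ℤ + a * (+ 2 * N) ≡ + 2 * N * a - b
  entry₂ = solve-∀

reflectRows-turnColumns-*-pinwheelMatrix : ∀ n a b c d →
  reflectRows (turnColumns (mat a b c d)) *ᴹ pinwheelMatrix n ≡
  mat a     (+ 2 * + n * a - b)
      (- c) (d - + 2 * + n * c)
reflectRows-turnColumns-*-pinwheelMatrix n a b c d =
  mat-cong (entry₁ a b) (entry₂ a b (+ n)) (entry₃ c d) (entry₄ c d (+ n))
  where
  entry₁ : ∀ a b → - b * 0ℤ + a * 1ℤ ≡ a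
  entry₁ = solve-∀
  entry₂ : ∀ a b N → - b * 1ℤ + a * (+ 2 * N) ≡ + 2 * N * a - b
  entry₂ = solve-∀
  entry₃ : ∀ c d → - (- d) * 0ℤ + - c * 1ℤ ≡ - c
  entry₃ = solve-∀
  entry₄ : ∀ c d N → - (- d) * 1ℤ + - c * (+ 2 * N) ≡ d - + 2 * N * c
  entry₄ = solve-∀

pinwheelMatrix-new : ∀ {n} → 0 < n → ∀ i → pinwheelMatrix n ≢ directionMatrix i
pinwheelMatrix-new {suc n} _ d₁ ()
pinwheelMatrix-new {suc n} _ d₂ ()
pinwheelMatrix-new {suc n} _ d₃ ()
pinwheelMatrix-new {suc n} _ d₄ ()
pinwheelMatrix-new {suc n} _ d₅ ()
pinwheelMatrix-new {suc n} _ d₆ ()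
pinwheelMatrix-new {suc n} _ d₇ ()
pinwheelMatrix-new {suc n} _ d₈ ()

module _ {n d : ℕ} where
  open LabelledGraph (pinwheelGraph n d) using (Vertex)

  vertexInvolution : (f : Coordinates → Coordinates) → (∀ x → f (f x) ≡ x) →
    (∀ x → Region n d (proj₂ x) → Region n d (proj₂ (f x))) → Vertex ↔ Vertex
  vertexInvolution f involutive preserves = mk↔ₛ′ g g g-involutive g-involutive
    where
    g : Vertex → Vertex
    g (x , [ r ]) = f x , [ preserves x r ]
    g-involutive : ∀ x → g (g x) ≡ x
    g-involutive (x , _) = value-injective (involutive x)

-- For odd n = 2m + 1, half-turns of the four rectangles give η.
module OddOrder (n d : ℕ) (m : ℤ) (n≡ : + n ≡ 1ℤ + + 2 * m) where
  private
    N = + n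
    D = + d

  halfTurn : Coordinates → Coordinates
  halfTurn (k , u , v) = k , m - u , m + 1ℤ - v

  private
    halfTurn-involutive : ∀ x → halfTurn (halfTurn x) ≡ x
    halfTurn-involutive (k , u , v) = cong₂ (λ u v → k , u , v) (entry₁ m u) (entry₂ m v)
      where
      entry₁ : ∀ m u → m - (m - u) ≡ u
      entry₁ = solve-∀
      entry₂ : ∀ m v → m + 1ℤ - (m + 1ℤ - v) ≡ v
      entry₂ = solve-∀

    halfTurn-region : ∀ x → Region n d (proj₂ x) → Region n d (proj₂ (halfTurn x))
    halfTurn-region (k , u , v) (region s⁻ s⁺ t⁻ t⁺) = region
      (0≤-resp (e₁ N n≡) s⁺) (0≤-resp (e₂ N n≡) s⁻) (0≤-resp (e₃ N D m u v) t⁺) (0≤-resp (e₄ N D m u v) t⁻)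
      where
      r₁ : ∀ m D u v → D + ((m - u) + (m + 1ℤ - v)) ≡ (1ℤ + + 2 * m) + D - (u + v)
      r₁ = solve-∀
      e₁ : ∀ N → N ≡ 1ℤ + + 2 * m → D + ((m - u) + (m + 1ℤ - v)) ≡ N + D - (u + v)
      e₁ N refl = r₁ m D u v
      r₂ : ∀ m D u v → (1ℤ + + 2 * m) + D - ((m - u) + (m + 1ℤ - v)) ≡ D + (u + v)
      r₂ = solve-∀
      e₂ : ∀ N → N ≡ 1ℤ + + 2 * m → N + D - ((m - u) + (m + 1ℤ - v)) ≡ D + (u + v)
      e₂ N refl = r₂ m D u v
      e₃ : ∀ N D m u v → N + D - 1ℤ + ((m + 1ℤ - v) - (m - u)) ≡ N + D - (v - u)
      e₃ = solve-∀
      e₄ : ∀ N D m u v → N + D - ((m + 1ℤ - v) - (m - u)) ≡ N + D - 1ℤ + (v - u)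
      e₄ = solve-∀

    offset : Matrix
    offset = mat 0ℤ (1ℤ - N)
                 0ℤ (1ℤ - N)

    halfTurn-affine : ∀ x → turnColumns (positionMatrix (halfTurn x)) *ᴹ pinwheelMatrix n ≡
                         positionMatrix x +ᴹ offset
    halfTurn-affine (k , u , v) = go k
      where
      entry : ∀ a b c d {a′ b′ c′ d′} →
        a ≡ a′ → + 2 * N * a - b ≡ b′ → c ≡ c′ → + 2 * N * c - d ≡ d′ →
        turnColumns (mat a b c d) *ᴹ pinwheelMatrix n ≡ mat a′ b′ c′ d′
      entry a b c d p q r s =
        trans (turnColumns-*-pinwheelMatrix n a b c d) (mat-cong p q r s)
      r₁ : ∀ m u → + 2 * (1ℤ + + 2 * m) * 0ℤ - + 2 * (m - u) ≡ + 2 * u + (1ℤ - (1ℤ + + 2 * m))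
      r₁ = solve-∀
      r₂ : ∀ m v → + 2 * (1ℤ + + 2 * m) * 0ℤ - (+ 2 * (m + 1ℤ - v) - 1ℤ) ≡ + 2 * v - 1ℤ + (1ℤ - (1ℤ + + 2 * m))
      r₂ = solve-∀
      r₃ : ∀ m v → + 2 * (1ℤ + + 2 * m) * -1ℤ - (- (+ 2 * (m + 1ℤ - v))) ≡ - (+ 2 * v) + (1ℤ - (1ℤ + + 2 * m))
      r₃ = solve-∀
      r₄ : ∀ m u → + 2 * (1ℤ + + 2 * m) * -1ℤ - (- (+ 2 * (m - u)) - 1ℤ) ≡ - (+ 2 * u) - 1ℤ + (1ℤ - (1ℤ + + 2 * m))
      r₄ = solve-∀
      e₁ : ∀ N → N ≡ 1ℤ + + 2 * m → + 2 * N * 0ℤ - + 2 * (m - u) ≡ + 2 * u + (1ℤ - N)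
      e₁ N refl = r₁ m u
      e₂ : ∀ N → N ≡ 1ℤ + + 2 * m → + 2 * N * 0ℤ - (+ 2 * (m + 1ℤ - v) - 1ℤ) ≡ + 2 * v - 1ℤ + (1ℤ - N)
      e₂ N refl = r₂ m v
      e₃ : ∀ N → N ≡ 1ℤ + + 2 * m → + 2 * N * -1ℤ - (- (+ 2 * (m + 1ℤ - v))) ≡ - (+ 2 * v) + (1ℤ - N)
      e₃ N refl = r₃ m v
      e₄ : ∀ N → N ≡ 1ℤ + + 2 * m → + 2 * N * -1ℤ - (- (+ 2 * (m - u)) - 1ℤ) ≡ - (+ 2 * u) - 1ℤ + (1ℤ - N)
      e₄ N refl = r₄ m u
      go : ∀ k → turnColumns (positionMatrix (halfTurn (k , u , v))) *ᴹ pinwheelMatrix n ≡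
                 positionMatrix (k , u , v) +ᴹ offset
      go 0F = entry 0ℤ _ 0ℤ _ refl (e₁ N n≡) refl (e₂ N n≡)
      go 1F = entry -1ℤ _ 0ℤ _ refl (e₃ N n≡) refl (e₁ N n≡)
      go 2F = entry -1ℤ _ -1ℤ _ refl (e₄ N n≡) refl (e₃ N n≡)
      go 3F = entry 0ℤ _ -1ℤ _ refl (e₂ N n≡) refl (e₄ N n≡)

  η : LabelledGraph.Vertex (pinwheelGraph n d) ↔ LabelledGraph.Vertex (pinwheelGraph n d)
  η = vertexInvolution halfTurn halfTurn-involutive halfTurn-region

  complement : Potential (relabel π-pinwheel (pinwheelGraph n d))
  complement = pinwheelComplement (pinwheelPotential n d)

  η-dualizes : Dualizes {pinwheelGraph n d} {relabel π-pinwheel (pinwheelGraph n d)}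
    (pinwheelPotential n d) (pinwheelMatrix n) η
  η-dualizes = dualizes-affine (pinwheelPotential n d) complement (pinwheelMatrix n)
    (pinwheelMatrix⁻¹ n) offset (*-pinwheelMatrix-retract n) η (λ x → halfTurn-affine (value x))

-- For even n = 2m, η exchanges the quarters I and IV and the quarters II and
-- III, and reflects the rectangles, fixing v - u and exchanging the bounds of
-- u + v.
module EvenOrder (n d : ℕ) (m : ℤ) (n≡ : + n ≡ + 2 * m) where
  private
    N = + n
    D = + d
    mirror : Fin 4 → Fin 4
    mirror 0F = 3F
    mirror 1F = 2F
    mirror 2F = 1F
    mirror 3F = 0F

  reflect : Coordinates → Coordinates
  reflect (k , u , v) = mirror k , m - v , m - u

  private
    reflect-involutive : ∀ x → reflect (reflect x) ≡ x
    reflect-involutive (k , u , v) =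
      cong₂ _,_ (mirror-involutive k) (cong₂ _,_ (entry m u) (entry m v))
      where
      mirror-involutive : ∀ k → mirror (mirror k) ≡ k
      mirror-involutive = λ { 0F → refl ; 1F → refl ; 2F → refl ; 3F → refl }
      entry : ∀ m u → m - (m - u) ≡ u
      entry = solve-∀

    reflect-region : ∀ x → Region n d (proj₂ x) → Region n d (proj₂ (reflect x))
    reflect-region (k , u , v) (region s⁻ s⁺ t⁻ t⁺) = region
      (0≤-resp (e₁ N n≡) s⁺) (0≤-resp (e₂ N n≡) s⁻) (0≤-resp (e₃ N D m u v) t⁻) (0≤-resp (e₄ N D m u v) t⁺)
      where
      r₁ : ∀ m D u v → D + ((m - v) + (m - u)) ≡ + 2 * m + D - (u + v)
      r₁ = solve-∀
      e₁ : ∀ N → N ≡ + 2 * m → D + ((m - v) + (m - u)) ≡ N + D - (u + v)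
      e₁ N refl = r₁ m D u v
      r₂ : ∀ m D u v → + 2 * m + D - ((m - v) + (m - u)) ≡ D + (u + v)
      r₂ = solve-∀
      e₂ : ∀ N → N ≡ + 2 * m → N + D - ((m - v) + (m - u)) ≡ D + (u + v)
      e₂ N refl = r₂ m D u v
      e₃ : ∀ N D m u v → N + D - 1ℤ + ((m - u) - (m - v)) ≡ N + D - 1ℤ + (v - u)
      e₃ = solve-∀
      e₄ : ∀ N D m u v → N + D - ((m - u) - (m - v)) ≡ N + D - (v - u)
      e₄ = solve-∀

    offset : Matrix
    offset = mat 0ℤ (1ℤ - N)
                 1ℤ N

    reflect-affine : ∀ x →
      reflectRows (turnColumns (positionMatrix (reflect x))) *ᴹ pinwheelMatrix n ≡
      positionMatrix x +ᴹ offset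
    reflect-affine (k , u , v) = go k
      where
      entry : ∀ a b c d {a′ b′ c′ d′} →
        a ≡ a′ → + 2 * N * a - b ≡ b′ → - c ≡ c′ → d - + 2 * N * c ≡ d′ →
        reflectRows (turnColumns (mat a b c d)) *ᴹ pinwheelMatrix n ≡ mat a′ b′ c′ d′
      entry a b c d p q r s =
        trans (reflectRows-turnColumns-*-pinwheelMatrix n a b c d) (mat-cong p q r s)
      r₁ : ∀ m u → + 2 * (+ 2 * m) * 0ℤ - (+ 2 * (m - u) - 1ℤ) ≡ + 2 * u + (1ℤ - + 2 * m)
      r₁ = solve-∀
      r₂ : ∀ m v → - (+ 2 * (m - v)) - 1ℤ - + 2 * (+ 2 * m) * -1ℤ ≡ + 2 * v - 1ℤ + + 2 * m
      r₂ = solve-∀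
      r₃ : ∀ m v → + 2 * (+ 2 * m) * -1ℤ - (- (+ 2 * (m - v)) - 1ℤ) ≡ - (+ 2 * v) + (1ℤ - + 2 * m)
      r₃ = solve-∀
      r₄ : ∀ m u → - (+ 2 * (m - u)) - + 2 * (+ 2 * m) * -1ℤ ≡ + 2 * u + + 2 * m
      r₄ = solve-∀
      r₅ : ∀ m u → + 2 * (+ 2 * m) * -1ℤ - (- (+ 2 * (m - u))) ≡ - (+ 2 * u) - 1ℤ + (1ℤ - + 2 * m)
      r₅ = solve-∀
      r₆ : ∀ m v → + 2 * (m - v) - + 2 * (+ 2 * m) * 0ℤ ≡ - (+ 2 * v) + + 2 * m
      r₆ = solve-∀
      r₇ : ∀ m v → + 2 * (+ 2 * m) * 0ℤ - + 2 * (m - v) ≡ + 2 * v - 1ℤ + (1ℤ - + 2 * m)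
      r₇ = solve-∀
      r₈ : ∀ m u → + 2 * (m - u) - 1ℤ - + 2 * (+ 2 * m) * 0ℤ ≡ - (+ 2 * u) - 1ℤ + + 2 * m
      r₈ = solve-∀
      go : ∀ k → reflectRows (turnColumns (positionMatrix (reflect (k , u , v)))) *ᴹ pinwheelMatrix n ≡
                 positionMatrix (k , u , v) +ᴹ offset
      go 0F = entry 0ℤ _ -1ℤ (- (+ 2 * (m - v)) - 1ℤ) refl (e N n≡) refl (e′ N n≡)
        where
        e : ∀ N → N ≡ + 2 * m → + 2 * N * 0ℤ - (+ 2 * (m - u) - 1ℤ) ≡ + 2 * u + (1ℤ - N)
        e N refl = r₁ m u
        e′ : ∀ N → N ≡ + 2 * m → - (+ 2 * (m - v)) - 1ℤ - + 2 * N * -1ℤ ≡ + 2 * v - 1ℤ + N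
        e′ N refl = r₂ m v
      go 1F = entry -1ℤ _ -1ℤ (- (+ 2 * (m - u))) refl (e N n≡) refl (e′ N n≡)
        where
        e : ∀ N → N ≡ + 2 * m → + 2 * N * -1ℤ - (- (+ 2 * (m - v)) - 1ℤ) ≡ - (+ 2 * v) + (1ℤ - N)
        e N refl = r₃ m v
        e′ : ∀ N → N ≡ + 2 * m → - (+ 2 * (m - u)) - + 2 * N * -1ℤ ≡ + 2 * u + N
        e′ N refl = r₄ m u
      go 2F = entry -1ℤ _ 0ℤ (+ 2 * (m - v)) refl (e N n≡) refl (e′ N n≡)
        where
        e : ∀ N → N ≡ + 2 * m → + 2 * N * -1ℤ - (- (+ 2 * (m - u))) ≡ - (+ 2 * u) - 1ℤ + (1ℤ - N)
        e N refl = r₅ m u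
        e′ : ∀ N → N ≡ + 2 * m → + 2 * (m - v) - + 2 * N * 0ℤ ≡ - (+ 2 * v) + N
        e′ N refl = r₆ m v
      go 3F = entry 0ℤ _ 0ℤ (+ 2 * (m - u) - 1ℤ) refl (e N n≡) refl (e′ N n≡)
        where
        e : ∀ N → N ≡ + 2 * m → + 2 * N * 0ℤ - + 2 * (m - v) ≡ + 2 * v - 1ℤ + (1ℤ - N)
        e N refl = r₇ m v
        e′ : ∀ N → N ≡ + 2 * m → + 2 * (m - u) - 1ℤ - + 2 * N * 0ℤ ≡ - (+ 2 * u) - 1ℤ + N
        e′ N refl = r₈ m u

  η : LabelledGraph.Vertex (pinwheelGraph n d) ↔ LabelledGraph.Vertex (pinwheelGraph n d)
  η = vertexInvolution reflect reflect-involutive reflect-region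

  complement : Potential (relabel π-reflect (relabel π-pinwheel (pinwheelGraph n d)))
  complement = reflectComplement (pinwheelComplement (pinwheelPotential n d))

  η-dualizes : Dualizes {pinwheelGraph n d} {relabel π-reflect (relabel π-pinwheel (pinwheelGraph n d))}
    (pinwheelPotential n d) (pinwheelMatrix n) η
  η-dualizes = dualizes-affine (pinwheelPotential n d) complement (pinwheelMatrix n)
    (pinwheelMatrix⁻¹ n) offset (*-pinwheelMatrix-retract n) η (λ x → reflect-affine (value x))

------------------------------------------------------------------------
-- The graph of the second leaper

module SecondLeaper (n d : ℕ) (n>0 : 0 < n) (L M : Leaper)
  (p≢0 : Leaper.p L ≢ 0) (p<q : Leaper.p L < Leaper.q L)
  (M≡ : Leaper.vector M ≡ pinwheelMatrix n *ᵛ Leaper.vector L) where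
  private
    module L = Leaper L
    module M = Leaper M
    A = pinwheelMatrix n
    B = expandedPinwheelBoard n d L
    W = pinwheelGraph n d
    V = pinwheelPotential n d
  open BoardVertices n d L p≢0 p<q

  -- The moves of M are the displacements directionMatrix i *ᴹ A of positions,
  -- hence η takes them to the arcs of the complement.
  leaperGraph-dual : ∀ {Φ′} η → Dualizes {W} {Φ′} V A η →
    Isomorphism (leaperGraph M B) (LabelledGraph.underlying Φ′)
  leaperGraph-dual {Φ′} η dualizes = record
    { bijection = ↔-trans squares↔vertices η
    ; edges     = λ {a} {b} → mk⇔
        (λ move → let (i , eq) = Equivalence.to (move⇔ M {value a} {value b}) move in
          i , Equivalence.from (dualizes (vertexOf a) (vertexOf b) i) (Equivalence.to (displaced a b i)
                (trans eq (cong (value a +ᵛ_) (M-vector i)))))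
        (λ (i , arc) → Equivalence.from (move⇔ M {value a} {value b})
          (i , trans (Equivalence.from (displaced a b i)
                       (Equivalence.to (dualizes (vertexOf a) (vertexOf b) i) arc))
                     (cong (value a +ᵛ_) (sym (M-vector i)))))
    }
    where
    M-vector : ∀ i → directionMatrix i *ᵛ M.vector ≡ (directionMatrix i *ᴹ A) *ᵛ L.vector
    M-vector i = trans (cong (directionMatrix i *ᵛ_) M≡) (*ᵛ-assoc (directionMatrix i) A L.vector)
    displaced : ∀ (a b : SquareOf B) i → value b ≡ value a +ᵛ (directionMatrix i *ᴹ A) *ᵛ L.vector ⇔
      positionMatrix (value (vertexOf b)) ≡ positionMatrix (value (vertexOf a)) +ᴹ directionMatrix i *ᴹ A
    displaced a b i = square-displacement⇔ {a} {b} (direction*pinwheel-isStep n i)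

  distinct : ¬ SameLeaper L M
  distinct (inj₁ (p≡r , _)) = ℕ.<⇒≢ p<q (trans p≡r r≡q)
    where
    e : ∀ P Q → 0ℤ * P + 1ℤ * Q ≡ Q
    e = solve-∀
    r≡q : M.p ≡ L.q
    r≡q = +-injective (trans (cong proj₁ M≡) (e (+ L.p) (+ L.q)))
  distinct (inj₂ (p≡s , _)) = ℕ.<⇒≢ p<s p≡s
    where
    e : ∀ P Q N → 1ℤ * P + + 2 * N * Q ≡ P + + 2 * (N * Q)
    e = solve-∀
    s≡ : M.q ≡ L.p ℕ.+ 2 ℕ.* (n ℕ.* L.q)
    s≡ = +-injective (trans (cong proj₂ M≡) (trans (e (+ L.p) (+ L.q) (+ n))
      (cong (λ x → + L.p + x) (sym (trans (pos-* 2 (n ℕ.* L.q)) (cong (λ x → + 2 * x) (pos-* n L.q)))))))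
    p<s : L.p < M.q
    p<s = subst (L.p <_) (sym s≡) (ℕ.m<m+n L.p
      (ℕ.*-mono-< {0} {2} (ℕ.s≤s z≤n) (ℕ.*-mono-< n>0 (ℕ.≤-<-trans z≤n p<q))))

  manySquares : ∃₂ λ (a b : SquareOf B) → a ≢ b
  manySquares = squareOf x , squareOf y , λ eq → x≢y
    (trans (sym (strictlyInverseˡ x)) (trans (cong vertexOf eq) (strictlyInverseˡ y)))
    where
    open Inverse squares↔vertices using (strictlyInverseˡ)
    x y : LabelledGraph.Vertex W
    x = center₀ n>0 0F
    y = center₀ n>0 1F
    x≢y : x ≢ y
    x≢y eq with () ← cong (proj₁ ∘ value) eq

  isDualBoard : ∀ {Φ′} η → Dualizes {W} {Φ′} V A η →
    Isomorphism (LabelledGraph.underlying W) (LabelledGraph.underlying Φ′) → IsDualBoard B L M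
  isDualBoard η dualizes W≅Φ′ = record
    { distinct    = distinct
    ; manySquares = manySquares
    ; connectedˡ  = connectedˡ
    ; connectedʳ  = connected-respects L≅M connectedˡ
    ; isomorphic  = L≅M
    }
    where
    L≅W : Isomorphism (leaperGraph L B) (LabelledGraph.underlying W)
    L≅W = isomorphism-trans leaperGraph-extracted (≅⇒isomorphism extracted≅pinwheelGraph)
    L≅M : Isomorphism (leaperGraph L B) (leaperGraph M B)
    L≅M = isomorphism-trans L≅W
      (isomorphism-trans W≅Φ′ (isomorphism-sym (leaperGraph-dual η dualizes)))
    connectedˡ : Connected (leaperGraph L B)
    connectedˡ = connected-respects (isomorphism-sym L≅W) (pinwheel-connected n>0)

halve-odd : ∀ n → 2 ∤ n → ∃[ m ] + n ≡ 1ℤ + + 2 * m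
halve-odd n 2∤n = + (n ℕ./ 2) , trans (cong +_ n≡) (cong (λ x → 1ℤ + x) (pos-* 2 (n ℕ./ 2)))
  where
  remainder : ∀ r → n ℕ.% 2 ≡ r → r < 2 → r ≡ 1
  remainder 0 eq _ = contradiction (m%n≡0⇒n∣m n 2 eq) 2∤n
  remainder 1 _  _ = refl
  remainder (suc (suc _)) _ (ℕ.s≤s (ℕ.s≤s ()))
  n≡ : n ≡ 1 ℕ.+ 2 ℕ.* (n ℕ./ 2)
  n≡ = trans (m≡m%n+[m/n]*n n 2)
    (cong₂ ℕ._+_ (remainder (n ℕ.% 2) refl (m%n<n n 2)) (ℕ.*-comm (n ℕ./ 2) 2))

halve-even : ∀ n → 2 ∣ n → ∃[ m ] + n ≡ + 2 * m
halve-even n (divides m eq) =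
  + m , trans (cong +_ (trans eq (ℕ.*-comm m 2))) (pos-* 2 m)

theorem25 : ∀ (n d : ℕ) → 0 < n → 0 < d →
    (∀ (L M : Leaper) → Leaper.p L ≢ 0 → Leaper.p L < Leaper.q L →
    Leaper.vector M ≡ pinwheelMatrix n *ᵛ Leaper.vector L →
    IsDualBoard (expandedPinwheelBoard n d L) L M)
    × (Σ[ W ∈ LabelledGraph ]
    (∀ (L : Leaper) → Leaper.p L ≢ 0 → Leaper.p L < Leaper.q L →
    IsTrivial L (expandedPinwheelBoard n d L)
    × IsDirectionGraph (extracted L (expandedPinwheelBoard n d L))
    × extracted L (expandedPinwheelBoard n d L) ≅ W)
    × (2 ∤ n → IsDual W (relabel π-pinwheel W) (pinwheelMatrix n))
    × (2 ∣ n → IsDual W (relabel π-reflect (relabel π-pinwheel W)) (pinwheelMatrix n)))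
theorem25 n d n>0 _ = dualBoard , W , structure , dualOdd , dualEven
  where
  W = pinwheelGraph n d
  V = pinwheelPotential n d
  iso-odd = relabel-isomorphism π-pinwheel W
  iso-even = isomorphism-trans iso-odd (relabel-isomorphism π-reflect (relabel π-pinwheel W))

  dualBoard : ∀ (L M : Leaper) → Leaper.p L ≢ 0 → Leaper.p L < Leaper.q L →
    Leaper.vector M ≡ pinwheelMatrix n *ᵛ Leaper.vector L →
    IsDualBoard (expandedPinwheelBoard n d L) L M
  dualBoard L M p≢0 p<q M≡ with 2 ∣? n
  ... | no 2∤n = let (m , n≡) = halve-odd n 2∤n in
    isDualBoard {relabel π-pinwheel W} (OddOrder.η n d m n≡) (OddOrder.η-dualizes n d m n≡) iso-odd
    where open SecondLeaper n d n>0 L M p≢0 p<q M≡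
  ... | yes 2∣n = let (m , n≡) = halve-even n 2∣n in
    isDualBoard {relabel π-reflect (relabel π-pinwheel W)}
      (EvenOrder.η n d m n≡) (EvenOrder.η-dualizes n d m n≡) iso-even
    where open SecondLeaper n d n>0 L M p≢0 p<q M≡

  structure : ∀ (L : Leaper) → Leaper.p L ≢ 0 → Leaper.p L < Leaper.q L →
    IsTrivial L (expandedPinwheelBoard n d L)
    × IsDirectionGraph (extracted L (expandedPinwheelBoard n d L))
    × extracted L (expandedPinwheelBoard n d L) ≅ W
  structure L p≢0 p<q =
      (λ w _ _ → closed-total extractedPotential w)
    , isDirectionGraph extractedPotential
    , extracted≅pinwheelGraph
    where open BoardVertices n d L p≢0 p<q

  dualOdd : 2 ∤ n → IsDual W (relabel π-pinwheel W) (pinwheelMatrix n)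
  dualOdd 2∤n = let (m , n≡) = halve-odd n 2∤n in
    isDual {W} {relabel π-pinwheel W} V (OddOrder.complement n d m n≡) (pinwheel-connected n>0) iso-odd
      (pinwheelMatrix-new n>0) (OddOrder.η n d m n≡) (OddOrder.η-dualizes n d m n≡)

  dualEven : 2 ∣ n → IsDual W (relabel π-reflect (relabel π-pinwheel W)) (pinwheelMatrix n)
  dualEven 2∣n = let (m , n≡) = halve-even n 2∣n in
    isDual {W} {relabel π-reflect (relabel π-pinwheel W)} V
      (EvenOrder.complement n d m n≡) (pinwheel-connected n>0) iso-even
      (pinwheelMatrix-new n>0) (EvenOrder.η n d m n≡) (EvenOrder.η-dualizes n d m n≡)
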